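{- Let $\phi$ be a numbering with the Kolmogorov property and let $f$ be a computable function mapping each index $x$ to a finite list of indices containing $\min_\phi(x)$. Then $|f(x)|=\Omega(\log^2 x)$ for infinitely many $x$; that is, there is a constant $c>0$ such that $|f(x)|\ge c\log^2 x$ for infinitely many $x$.
   Context: A numbering $\phi$ is given by a partial-recursive function $U:\mathbb{N}^2\to\mathbb{N}$ via $\phi_e(x)=U(e,x)$. $\phi$ has the Kolmogorov property if for every numbering $\psi$ there exist a constant $c>0$ and a (not necessarily computable) function $t$ with $t(e)\le ce+c$ and $\phi_{t(e)}=\psi_e$ for all $e$. $\min_\phi(e)$ is the least $j$ with $\phi_j=\phi_e$. $|f(x)|$ denotes the number of elements of the list $f(x)$. -}

module Defs where

open import Data.Nat using (ℕ; zero; suc; _+_; _*_; _≤_; _<_; _^_)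
open import Data.Nat.Logarithm using (⌊log₂_⌋)
open import Data.Fin using (Fin)
open import Data.Vec using (Vec; []; _∷_; lookup)
open import Data.List using (List; length)
open import Data.List.Membership.Propositional using (_∈_)
open import Data.Product using (Σ; ∃; _×_)
open import Relation.Nullary using (¬_)
open import Function.Bundles using (_⇔_)

data PR : ℕ → Set where
  Z    : ∀ {k} → PR k
  S    : PR 1
  P    : ∀ {k} → Fin k → PR k
  comp : ∀ {k m} → PR m → Vec (PR k) m → PR k
  prec : ∀ {k} → PR k → PR (suc (suc k)) → PR (suc k)
  mu   : ∀ {k} → PR (suc k) → PR k

mutual
  data Eval : ∀ {k} → PR k → Vec ℕ k → ℕ → Set where
    eZ    : ∀ {k} {xs : Vec ℕ k} → Eval Z xs 0
    eS    : ∀ {x} → Eval S (x ∷ []) (suc x)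
    eP    : ∀ {k} {i : Fin k} {xs} → Eval (P i) xs (lookup xs i)
    eComp : ∀ {k m} {g : PR m} {hs : Vec (PR k) m} {xs ys y} →
            EvalAll hs xs ys → Eval g ys y → Eval (comp g hs) xs y
    ePrec0 : ∀ {k} {g : PR k} {h xs y} → Eval g xs y → Eval (prec g h) (0 ∷ xs) y
    ePrecS : ∀ {k} {g : PR k} {h n xs r y} →
             Eval (prec g h) (n ∷ xs) r → Eval h (n ∷ r ∷ xs) y →
             Eval (prec g h) (suc n ∷ xs) y
    eMu   : ∀ {k} {f : PR (suc k)} {xs n} →
            Eval f (n ∷ xs) 0 →
            (∀ m → m < n → Σ ℕ (λ v → Eval f (m ∷ xs) (suc v))) →
            Eval (mu f) xs n

  data EvalAll : ∀ {k m} → Vec (PR k) m → Vec ℕ k → Vec ℕ m → Set where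
    []  : ∀ {k} {xs : Vec ℕ k} → EvalAll [] xs []
    _∷_ : ∀ {k m} {h : PR k} {hs : Vec (PR k) m} {xs y ys} →
          Eval h xs y → EvalAll hs xs ys → EvalAll (h ∷ hs) xs (y ∷ ys)

-- A numbering is given by a partial-recursive U : ℕ² → ℕ, φ_e(x) = U(e,x).
Numbering : Set
Numbering = PR 2

SameFn : Numbering → ℕ → Numbering → ℕ → Set
SameFn U a V b = ∀ x y → Eval U (a ∷ x ∷ []) y ⇔ Eval V (b ∷ x ∷ []) y

Kolmogorov : Numbering → Set
Kolmogorov φ = ∀ (ψ : Numbering) →
  Σ ℕ λ c → (0 < c) × Σ (ℕ → ℕ) λ t →
    ∀ e → (t e ≤ c * e + c) × SameFn φ (t e) ψ e

IsMinIndex : Numbering → ℕ → ℕ → Set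
IsMinIndex φ e j = SameFn φ j φ e × (∀ i → i < j → ¬ SameFn φ i φ e)

ComputableList : (ℕ → List ℕ) → Set
ComputableList f = Σ (PR 1) λ L → Σ (PR 2) λ H →
  (∀ x → Eval L (x ∷ []) (length (f x))) ×
  (∀ x (i : Fin (length (f x))) →
     Eval H (x ∷ Data.Fin.toℕ i ∷ []) (Data.List.lookup (f x) i))

log² : ℕ → ℕ
log² x = ⌊log₂ x ⌋ * ⌊log₂ x ⌋

{-# OPTIONS --safe #-}
module Submission where

-- If G is partial recursive, the Kolmogorov property bounds the minimal index of φ_{G e} by
-- c e + c.  Suppose that the lists f x were short for all large x.  Let x_y ≤ c₀ y + c₀ be
-- φ-indices of the constant functions y, for y < M with M about 2 ^ (4 n).  A list of length ≤ ε n²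
-- has few entries, say ≤ d = ε′ n, in one of ε′ n disjoint ranges of the form [2 ^ (k ∸ 2) , 2 ^ (k + C))
-- with n ≤ k < 2 n, so by pigeonhole many y share such a k.  Cut the range into n blocks and note
-- which of them f (x_y) meets: this takes n bits, so at least 2 ^ k of those y meet the same blocks,
-- at most d in number, which contain at most 2 ^ k / 2 numbers in total.  A search finds such a
-- family of 2 ^ k points, so G can list it on [2 ^ k , 2 ^ (1 + k)).  The minimal indices of its
-- members are then below 2 ^ (k + C), pairwise distinct and, being entries of the lists, below
-- 2 ^ (k ∸ 2) or in the shared blocks: there is no room for 2 ^ k of them.  Here n = 2 ^ j, and C is
-- read off from j, so that G needs no further input and yet C can be chosen after c.

open import Defs
open import Data.Nat using (ℕ; zero; suc; pred; _+_; _*_; _∸_; _^_; _≤_; _<_; _≥_; z≤n; s≤s; _⊔_; _≤?_; _<?_; _≟_; NonZero)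
open import Data.Nat.Properties
open import Data.Nat.DivMod using (_/_; _%_; m/n*n≤m; m<n*o⇒m/o<n; m≡m%n+[m/n]*n; m%n<n)
open import Data.Fin using (Fin; zero; suc; toℕ; fromℕ<; _↑ˡ_; _↑ʳ_; splitAt; combine; remQuot)
open import Data.Fin.Properties using (pigeonhole; toℕ-fromℕ<; toℕ<n; splitAt-↑ˡ; splitAt-↑ʳ; remQuot-combine)
open import Data.Vec using (Vec; []; _∷_; _++_; lookup; map; tabulate; drop)
open import Data.List using (List; []; _∷_; length; filter; upTo)
open import Data.List.Properties using (length-map; length-upTo; length-filter)
open import Data.List.Membership.Propositional using (_∈_; lose; find)
open import Data.List.Membership.Propositional.Properties using (∈-filter⁺; ∈-filter⁻; ∈-map⁺; ∈-upTo⁻)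
open import Data.List.Relation.Unary.Any using (Any; here; there; index; any?)
open import Data.List.Relation.Unary.Any.Properties using (lookup-index)
import Data.List.Relation.Unary.All as All
open import Data.List.Relation.Unary.Unique.Propositional using (Unique; []; _∷_)
open import Data.List.Relation.Unary.Unique.Propositional.Properties using (filter⁺; upTo⁺)
open import Data.Product using (Σ; _×_; _,_; proj₁; proj₂)
open import Data.Sum using (_⊎_; inj₁; inj₂; [_,_]′)
open import Data.Empty using (⊥; ⊥-elim)
open import Function using (_∘_)
open import Function.Bundles using (_⇔_; mk⇔; Equivalence)
open import Relation.Nullary using (¬_; Dec; yes; no; ¬?)
open import Relation.Nullary.Decidable using (_×-dec_)
open import Relation.Binary.Definitions using (tri<; tri≈; tri>)
open import Relation.Binary.PropositionalEquality
open import Data.Nat.Logarithm using (⌊log₂_⌋; ⌊log₂⌋-mono-≤; ⌊log₂[2^n]⌋≡n)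
open import Data.Nat.Tactic.RingSolver using (solve-∀)

-- Determinism of evaluation

mutual
  eval-functional : ∀ {k} (g : PR k) {xs y z} → Eval g xs y → Eval g xs z → y ≡ z
  eval-functional Z eZ eZ = refl
  eval-functional S eS eS = refl
  eval-functional (P i) eP eP = refl
  eval-functional (comp g hs) (eComp as b) (eComp as′ b′)
    with refl ← evalAll-functional hs as as′ = eval-functional g b b′
  eval-functional (prec g h) a b = prec-functional g h a b
  eval-functional (mu f) {xs} (eMu {n = n} a p) (eMu {n = m} b q) with <-cmp n m
  ... | tri< n<m _ _ with v , c ← q n n<m with () ← eval-functional f a c
  ... | tri≈ _ n≡m _ = n≡m
  ... | tri> _ _ m<n with v , c ← p m m<n with () ← eval-functional f b c

  prec-functional : ∀ {k} (g : PR k) (h : PR (suc (suc k))) {xs y z} →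
    Eval (prec g h) xs y → Eval (prec g h) xs z → y ≡ z
  prec-functional g h (ePrec0 a) (ePrec0 b) = eval-functional g a b
  prec-functional g h (ePrecS a b) (ePrecS a′ b′)
    with refl ← prec-functional g h a a′ = eval-functional h b b′

  evalAll-functional : ∀ {k m} (hs : Vec (PR k) m) {xs ys zs} →
    EvalAll hs xs ys → EvalAll hs xs zs → ys ≡ zs
  evalAll-functional [] [] [] = refl
  evalAll-functional (h ∷ hs) (a ∷ as) (b ∷ bs) =
    cong₂ _∷_ (eval-functional h a b) (evalAll-functional hs as bs)

-- Total computable functions

-- The value as an Agda function travels with its code, so that properties of computable functions
-- are proved about `fun` and not about derivations of `Eval`.
record Fn (k : ℕ) : Set where
  field
    fun   : Vec ℕ k → ℕ
    code  : PR k
    sound : ∀ xs → Eval code xs (fun xs)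
open Fn

recast : ∀ {k} (F : Fn k) (g : Vec ℕ k → ℕ) → (∀ xs → fun F xs ≡ g xs) → Fn k
recast F g eq .fun = g
recast F g eq .code = code F
recast F g eq .sound xs = subst (Eval (code F) xs) (eq xs) (sound F xs)

evalAll-codes : ∀ {k m} (Gs : Vec (Fn k) m) xs →
  EvalAll (map code Gs) xs (map (λ G → fun G xs) Gs)
evalAll-codes [] xs = []
evalAll-codes (G ∷ Gs) xs = sound G xs ∷ evalAll-codes Gs xs

evalAll-++ : ∀ {k m n} {gs : Vec (PR k) m} {hs : Vec (PR k) n} {xs ys zs} →
  EvalAll gs xs ys → EvalAll hs xs zs → EvalAll (gs ++ hs) xs (ys ++ zs)
evalAll-++ [] bs = bs
evalAll-++ (a ∷ as) bs = a ∷ evalAll-++ as bs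

evalAll-projections : ∀ {k m} (ρ : Fin m → Fin k) {xs} (ys : Vec ℕ m) →
  (∀ i → lookup xs (ρ i) ≡ lookup ys i) → EvalAll (tabulate (P ∘ ρ)) xs ys
evalAll-projections ρ [] eq = []
evalAll-projections ρ (y ∷ ys) eq =
  subst (Eval _ _) (eq zero) eP ∷ evalAll-projections (ρ ∘ suc) ys (eq ∘ suc)

lookup-↑ʳ : ∀ j {k} (xs : Vec ℕ (j + k)) i → lookup xs (j ↑ʳ i) ≡ lookup (drop j xs) i
lookup-↑ʳ zero xs i = refl
lookup-↑ʳ (suc j) (x ∷ xs) i = lookup-↑ʳ j xs i

ap : ∀ {k m} → Fn m → Vec (Fn k) m → Fn k
ap F Gs .fun xs = fun F (map (λ G → fun G xs) Gs)
ap F Gs .code = comp (code F) (map code Gs)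
ap F Gs .sound xs = eComp (evalAll-codes Gs xs) (sound F _)

-- Substitution under binders: the first `j` arguments give way to the values of `Gs`, and the
-- remaining ones pass through. Counters and accumulators of recursions are handled this way.
apPrefix : ∀ j {k m} → Fn (m + k) → Vec (Fn (j + k)) m → Fn (j + k)
apPrefix j F Gs .fun xs = fun F (map (λ G → fun G xs) Gs ++ drop j xs)
apPrefix j F Gs .code = comp (code F) (map code Gs ++ tabulate (P ∘ (j ↑ʳ_)))
apPrefix j F Gs .sound xs =
  eComp (evalAll-++ (evalAll-codes Gs xs) (evalAll-projections _ _ (lookup-↑ʳ j xs)))
        (sound F _)

arg : ∀ {k} → Fin k → Fn k
arg i .fun xs = lookup xs i
arg i .code = P i
arg i .sound xs = eP

module _ {k : ℕ} (G : Fn k) (H : Fn (suc (suc k))) where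
  recFun : ℕ → Vec ℕ k → ℕ
  recFun zero xs = fun G xs
  recFun (suc n) xs = fun H (n ∷ recFun n xs ∷ xs)

  recEval : ∀ n xs → Eval (prec (code G) (code H)) (n ∷ xs) (recFun n xs)
  recEval zero xs = ePrec0 (sound G xs)
  recEval (suc n) xs = ePrecS (recEval n xs) (sound H _)

  rec : Fn (suc k)
  rec .fun (n ∷ xs) = recFun n xs
  rec .code = prec (code G) (code H)
  rec .sound (n ∷ xs) = recEval n xs

pattern #0 = zero
pattern #1 = suc zero
pattern #2 = suc (suc zero)
pattern #3 = suc (suc (suc zero))

sucᶠ : ∀ {k} → Fn k → Fn k
sucᶠ F .fun xs = suc (fun F xs)
sucᶠ F .code = comp S (code F ∷ [])
sucᶠ F .sound xs = eComp (sound F xs ∷ []) eS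

lit : ∀ {k} → ℕ → Fn k
lit c .fun xs = c
lit zero .code = Z
lit (suc c) .code = comp S (code (lit c) ∷ [])
lit zero .sound xs = eZ
lit (suc c) .sound xs = eComp (sound (lit c) xs ∷ []) eS

infixl 6 _+ᶠ_ _∸ᶠ_
infixl 7 _*ᶠ_

plus : Fn 2
plus = recast R (λ xs → lookup xs #0 + lookup xs #1) λ { (a ∷ b ∷ []) → eq a b }
  where
  R : Fn 2
  R = rec (arg #0) (sucᶠ (arg #1))
  eq : ∀ a b → fun R (a ∷ b ∷ []) ≡ a + b
  eq zero b = refl
  eq (suc a) b = cong suc (eq a b)

_+ᶠ_ : ∀ {k} → Fn k → Fn k → Fn k
F +ᶠ G = ap plus (F ∷ G ∷ [])

times : Fn 2
times = recast R (λ xs → lookup xs #0 * lookup xs #1) λ { (a ∷ b ∷ []) → eq a b }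
  where
  R : Fn 2
  R = rec (lit 0) (arg #2 +ᶠ arg #1)
  eq : ∀ a b → fun R (a ∷ b ∷ []) ≡ a * b
  eq zero b = refl
  eq (suc a) b = cong (b +_) (eq a b)

_*ᶠ_ : ∀ {k} → Fn k → Fn k → Fn k
F *ᶠ G = ap times (F ∷ G ∷ [])

predecessor : Fn 1
predecessor = recast (rec (lit 0) (arg #0)) (λ xs → pred (lookup xs #0))
  λ { (zero ∷ []) → refl ; (suc a ∷ []) → refl }

predᶠ : ∀ {k} → Fn k → Fn k
predᶠ F = ap predecessor (F ∷ [])

monus : Fn 2
monus = recast R (λ xs → lookup xs #1 ∸ lookup xs #0) λ { (b ∷ a ∷ []) → eq b a }
  where
  R : Fn 2
  R = rec (arg #0) (predᶠ (arg #1))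
  eq : ∀ b a → fun R (b ∷ a ∷ []) ≡ a ∸ b
  eq zero a = refl
  eq (suc b) a = trans (cong pred (eq b a)) (pred[m∸n]≡m∸[1+n] a b)

_∸ᶠ_ : ∀ {k} → Fn k → Fn k → Fn k
F ∸ᶠ G = ap monus (G ∷ F ∷ [])

pow2 : Fn 1
pow2 = recast R (λ xs → 2 ^ lookup xs #0) λ { (a ∷ []) → eq a }
  where
  R : Fn 1
  R = rec (lit 1) (lit 2 *ᶠ arg #1)
  eq : ∀ a → fun R (a ∷ []) ≡ 2 ^ a
  eq zero = refl
  eq (suc a) = cong (2 *_) (eq a)

2^ᶠ_ : ∀ {k} → Fn k → Fn k
2^ᶠ F = ap pow2 (F ∷ [])

guardℕ : ℕ → ℕ → ℕ
guardℕ zero _ = 0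
guardℕ (suc _) y = y

guardFn : Fn 2
guardFn = recast (rec (lit 0) (arg #2)) (λ xs → guardℕ (lookup xs #0) (lookup xs #1))
  λ { (zero ∷ _ ∷ []) → refl ; (suc _ ∷ _ ∷ []) → refl }

guard : ∀ {k} → Fn k → Fn k → Fn k
guard F G = ap guardFn (F ∷ G ∷ [])

guardAll : ∀ {k m} → Vec (Fn k) m → Fn k → Fn k
guardAll [] F = F
guardAll (G ∷ Gs) F = guard G (guardAll Gs F)

-- Bounded sums, products and search

sumTo : ℕ → (ℕ → ℕ) → ℕ
sumTo zero a = 0
sumTo (suc n) a = a n + sumTo n a

prodTo : ℕ → (ℕ → ℕ) → ℕ
prodTo zero a = 1
prodTo (suc n) a = a n * prodTo n a

-- Once a positive term is found, the factor `1 ∸ firstTo n a` switches off all later ones; 0 means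
-- that none was found.
firstTo : ℕ → (ℕ → ℕ) → ℕ
firstTo zero a = 0
firstTo (suc n) a = firstTo n a + (1 ∸ firstTo n a) * a n

∑ : ∀ {k} → Fn k → Fn (suc k) → Fn k
∑ {k} b F = recast (apPrefix 0 R (b ∷ [])) (λ xs → sumTo (fun b xs) (λ i → fun F (i ∷ xs)))
    λ xs → eq (fun b xs) xs
  where
  R : Fn (suc k)
  R = rec (lit 0) (apPrefix 2 F (arg #0 ∷ []) +ᶠ arg #1)
  eq : ∀ n xs → fun R (n ∷ xs) ≡ sumTo n (λ i → fun F (i ∷ xs))
  eq zero xs = refl
  eq (suc n) xs = cong (fun F (n ∷ xs) +_) (eq n xs)

∏ : ∀ {k} → Fn k → Fn (suc k) → Fn k
∏ {k} b F = recast (apPrefix 0 R (b ∷ [])) (λ xs → prodTo (fun b xs) (λ i → fun F (i ∷ xs)))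
    λ xs → eq (fun b xs) xs
  where
  R : Fn (suc k)
  R = rec (lit 1) (apPrefix 2 F (arg #0 ∷ []) *ᶠ arg #1)
  eq : ∀ n xs → fun R (n ∷ xs) ≡ prodTo n (λ i → fun F (i ∷ xs))
  eq zero xs = refl
  eq (suc n) xs = cong (fun F (n ∷ xs) *_) (eq n xs)

first : ∀ {k} → Fn k → Fn (suc k) → Fn k
first {k} b F = recast (apPrefix 0 R (b ∷ [])) (λ xs → firstTo (fun b xs) (λ i → fun F (i ∷ xs)))
    λ xs → eq (fun b xs) xs
  where
  R : Fn (suc k)
  R = rec (lit 0) (arg #1 +ᶠ (lit 1 ∸ᶠ arg #1) *ᶠ apPrefix 2 F (arg #0 ∷ []))
  eq : ∀ n xs → fun R (n ∷ xs) ≡ firstTo n (λ i → fun F (i ∷ xs))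
  eq zero xs = refl
  eq (suc n) xs = cong (λ v → v + (1 ∸ v) * fun F (n ∷ xs)) (eq n xs)

sumTo≡0⇒ : ∀ n a → sumTo n a ≡ 0 → ∀ i → i < n → a i ≡ 0
sumTo≡0⇒ (suc n) a eq i i<1+n with m≤n⇒m<n∨m≡n (≤-pred i<1+n)
... | inj₁ i<n = sumTo≡0⇒ n a (m+n≡0⇒n≡0 (a n) eq) i i<n
... | inj₂ refl = m+n≡0⇒m≡0 (a n) eq

⇒sumTo≡0 : ∀ n a → (∀ i → i < n → a i ≡ 0) → sumTo n a ≡ 0
⇒sumTo≡0 zero a p = refl
⇒sumTo≡0 (suc n) a p = cong₂ _+_ (p n ≤-refl) (⇒sumTo≡0 n a λ i i<n → p i (m<n⇒m<1+n i<n))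

prodTo≡0⇒ : ∀ n a → prodTo n a ≡ 0 → Σ ℕ λ i → i < n × a i ≡ 0
prodTo≡0⇒ (suc n) a eq with m*n≡0⇒m≡0∨n≡0 (a n) eq
... | inj₁ p = n , ≤-refl , p
... | inj₂ p with i , i<n , q ← prodTo≡0⇒ n a p = i , m<n⇒m<1+n i<n , q

⇒prodTo≡0 : ∀ n a i → i < n → a i ≡ 0 → prodTo n a ≡ 0
⇒prodTo≡0 (suc n) a i i<1+n eq with m≤n⇒m<n∨m≡n (≤-pred i<1+n)
... | inj₁ i<n = trans (cong (a n *_) (⇒prodTo≡0 n a i i<n eq)) (*-zeroʳ (a n))
... | inj₂ refl = cong (_* prodTo n a) eq

firstTo-suc : ∀ n a {v} → firstTo n a ≡ suc v → firstTo (suc n) a ≡ suc v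
firstTo-suc n a {v} eq rewrite eq | 0∸n≡0 v = cong suc (+-identityʳ v)

firstTo-sound : ∀ n a {y} → firstTo n a ≡ suc y → Σ ℕ λ i → i < n × a i ≡ suc y
firstTo-sound (suc n) a eq = go (firstTo n a) refl eq
  where
  go : ∀ v → firstTo n a ≡ v → ∀ {y} → firstTo (suc n) a ≡ suc y → Σ ℕ λ i → i < suc n × a i ≡ suc y
  go zero p eq rewrite p = n , ≤-refl , trans (sym (+-identityʳ (a n))) eq
  go (suc v) p eq with i , i<n , q ← firstTo-sound n a p =
    i , m<n⇒m<1+n i<n , trans q (trans (sym (firstTo-suc n a p)) eq)

firstTo-complete : ∀ n a i {v} → i < n → a i ≡ suc v → Σ ℕ λ y → firstTo n a ≡ suc y
firstTo-complete (suc n) a i i<1+n eq = go (firstTo n a) refl (m≤n⇒m<n∨m≡n (≤-pred i<1+n))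
  where
  go : ∀ v → firstTo n a ≡ v → i < n ⊎ i ≡ n → Σ ℕ λ y → firstTo (suc n) a ≡ suc y
  go (suc v) p _ = v , firstTo-suc n a p
  go zero p (inj₂ refl) rewrite p = _ , trans (+-identityʳ (a n)) eq
  go zero p (inj₁ i<n) with y , q ← firstTo-complete n a i i<n eq = y , firstTo-suc n a q

-- Stage-bounded evaluation

-- The first argument of stage g is the number of stages; the value is 0 if g has not been seen
-- to converge by then and suc y if it has converged to y.
mutual
  stage : ∀ {k} → PR k → Fn (suc k)
  stage Z = lit 1
  stage S = sucᶠ (sucᶠ (arg #1))
  stage (P i) = sucᶠ (arg (suc i))
  stage (comp g hs) = guardAll (stages hs) (ap (stage g) (arg #0 ∷ map predᶠ (stages hs)))
  stage (prec g h) = apPrefix 2 (rec (stage g) (stageStep h)) (arg #1 ∷ arg #0 ∷ [])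
  -- Only candidates below the stage are tried. A verified candidate `i` contributes `suc i`, the
  -- mark of convergence to `i`; the others contribute 0.
  stage (mu f) = first (arg #0) ((lit 1 ∸ᶠ stageFailure f) *ᶠ sucᶠ (arg #0))

  stages : ∀ {k m} → Vec (PR k) m → Vec (Fn (suc k)) m
  stages [] = []
  stages (h ∷ hs) = stage h ∷ stages hs

  stageStep : ∀ {k} → PR (suc (suc k)) → Fn (suc (suc (suc k)))
  stageStep h = guard (arg #1) (apPrefix 3 (stage h) (arg #2 ∷ arg #0 ∷ predᶠ (arg #1) ∷ []))

  -- Vanishes at n ∷ s ∷ xs iff by stage s the value of f at n is seen to be 0 and those at
  -- all m < n are seen to be positive.
  stageFailure : ∀ {k} → PR (suc k) → Fn (suc (suc k))
  stageFailure f =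
    -- `V` is 1 exactly when the value 0 has been seen; the sum demands stage values of at least 2,
    -- that is, positive values of `f`.
    (V ∸ᶠ lit 1) +ᶠ (lit 1 ∸ᶠ V) +ᶠ
    ∑ (arg #0) (lit 2 ∸ᶠ apPrefix 3 (stage f) (arg #2 ∷ arg #0 ∷ []))
    where V = apPrefix 2 (stage f) (arg #1 ∷ arg #0 ∷ [])

guardℕ-suc : ∀ v {w y} → guardℕ v w ≡ suc y → v ≡ suc (pred v) × w ≡ suc y
guardℕ-suc (suc v) eq = refl , eq

1∸v≡0⇒v≡suc : ∀ v → 1 ∸ v ≡ 0 → v ≡ suc (pred v)
1∸v≡0⇒v≡suc (suc v) _ = refl

module _ {k : ℕ} (f : PR (suc k)) (s : ℕ) (xs : Vec ℕ k) where
  private V = λ n → fun (stage f) (s ∷ n ∷ xs)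

  stageFailure≡0⇒ : ∀ n → fun (stageFailure f) (n ∷ s ∷ xs) ≡ 0 →
    V n ≡ 1 × (∀ m → m < n → V m ≡ suc (suc (pred (pred (V m)))))
  stageFailure≡0⇒ n eq =
    ≤-antisym (m∸n≡0⇒m≤n (m+n≡0⇒m≡0 (V n ∸ 1) left)) (m∸n≡0⇒m≤n (m+n≡0⇒n≡0 (V n ∸ 1) left)) ,
    λ m m<n → two≤ (V m) (m∸n≡0⇒m≤n (sumTo≡0⇒ n _ (m+n≡0⇒n≡0 ((V n ∸ 1) + (1 ∸ V n)) eq) m m<n))
    where
    left = m+n≡0⇒m≡0 ((V n ∸ 1) + (1 ∸ V n)) eq
    two≤ : ∀ v → 2 ≤ v → v ≡ suc (suc (pred (pred v)))
    two≤ (suc (suc v)) _ = refl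
    two≤ (suc zero) (s≤s ())

  ⇒stageFailure≡0 : ∀ n → V n ≡ 1 → (∀ m → m < n → Σ ℕ λ v → V m ≡ suc (suc v)) →
    fun (stageFailure f) (n ∷ s ∷ xs) ≡ 0
  ⇒stageFailure≡0 n eq p = cong₂ _+_ (cong (λ v → (v ∸ 1) + (1 ∸ v)) eq)
    (⇒sumTo≡0 n _ λ m m<n → trans (cong (2 ∸_) (proj₂ (p m m<n))) (0∸n≡0 (proj₁ (p m m<n))))

mutual
  stage-sound : ∀ {k} (g : PR k) s xs {y} → fun (stage g) (s ∷ xs) ≡ suc y → Eval g xs y
  stage-sound Z s xs refl = eZ
  stage-sound S s (x ∷ []) refl = eS
  stage-sound (P i) s xs refl = eP
  stage-sound (comp g hs) s xs eq with as , b ← stages-sound hs _ s xs eq =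
    eComp as (stage-sound g s _ b)
  stage-sound (prec g h) s (n ∷ xs) eq = stage-sound-prec g h s n xs eq
  stage-sound (mu f) s xs eq
    with n , n<s , p ← firstTo-sound s _ eq
    with fun (stageFailure f) (n ∷ s ∷ xs) in q
  ... | suc w with () ← trans (sym p) (cong (_* suc n) (0∸n≡0 w))
  ... | zero with refl ← trans (sym (+-identityʳ (suc n))) p | a , b ← stageFailure≡0⇒ f s xs n q =
    eMu (stage-sound f s _ a) λ m m<n → _ , stage-sound f s _ (b m m<n)

  stage-sound-prec : ∀ {k} (g : PR k) h s n xs {y} →
    recFun (stage g) (stageStep h) n (s ∷ xs) ≡ suc y → Eval (prec g h) (n ∷ xs) y
  stage-sound-prec g h s zero xs eq = ePrec0 (stage-sound g s xs eq)
  stage-sound-prec g h s (suc n) xs eq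
    with p , q ← guardℕ-suc (recFun (stage g) (stageStep h) n (s ∷ xs)) eq =
    ePrecS (stage-sound-prec g h s n xs p) (stage-sound h s _ q)

  stages-sound : ∀ {k m} (hs : Vec (PR k) m) F s xs {y} →
    fun (guardAll (stages hs) F) (s ∷ xs) ≡ suc y →
    EvalAll hs xs (map (λ G → fun G (s ∷ xs)) (map predᶠ (stages hs))) × fun F (s ∷ xs) ≡ suc y
  stages-sound [] F s xs eq = [] , eq
  stages-sound (h ∷ hs) F s xs eq
    with p , q ← guardℕ-suc (fun (stage h) (s ∷ xs)) eq
    with as , b ← stages-sound hs F s xs q = stage-sound h s xs p ∷ as , b

-- Asking for all late stages, not just one, lets finitely many subcomputations meet at a common
-- stage.
Eventually : (ℕ → Set) → Set
Eventually A = Σ ℕ λ s₀ → ∀ s → s₀ ≤ s → A s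

eventually-map : ∀ {A B : ℕ → Set} → (∀ s → A s → B s) → Eventually A → Eventually B
eventually-map f (s₀ , a) = s₀ , λ s le → f s (a s le)

eventually-zip : ∀ {A B C : ℕ → Set} → (∀ s → A s → B s → C s) →
  Eventually A → Eventually B → Eventually C
eventually-zip f (s₀ , a) (s₁ , b) = s₀ ⊔ s₁ , λ s le →
  f s (a s (≤-trans (m≤m⊔n s₀ s₁) le)) (b s (≤-trans (m≤n⊔m s₀ s₁) le))

eventually-∀< : ∀ n {A : ℕ → ℕ → Set} →
  (∀ m → m < n → Eventually (A m)) → Eventually λ s → ∀ m → m < n → A m s
eventually-∀< zero p = 0 , λ _ _ _ ()
eventually-∀< (suc n) {A} p =
  eventually-zip (λ s a b m m<1+n → join s a b m (m≤n⇒m<n∨m≡n (≤-pred m<1+n)))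
    (p n ≤-refl) (eventually-∀< n λ m m<n → p m (m<n⇒m<1+n m<n))
  where
  join : ∀ s → A n s → (∀ m → m < n → A m s) → ∀ m → m < n ⊎ m ≡ n → A m s
  join s a b m (inj₁ m<n) = b m m<n
  join s a b m (inj₂ refl) = a

mutual
  stage-complete : ∀ {k} (g : PR k) {xs y} → Eval g xs y →
    Eventually λ s → fun (stage g) (s ∷ xs) ≡ suc y
  stage-complete Z eZ = 0 , λ _ _ → refl
  stage-complete S eS = 0 , λ _ _ → refl
  stage-complete (P i) eP = 0 , λ _ _ → refl
  stage-complete (comp g hs) {xs} (eComp as b) =
    eventually-zip (λ s p q → trans (proj₁ p _) (trans (cong (λ ys → fun (stage g) (s ∷ ys)) (proj₂ p)) q))
      (stages-complete hs as) (stage-complete g b)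
  stage-complete (prec g h) {n ∷ xs} a = stage-complete-prec g h a
  stage-complete (mu f) {xs} {n} (eMu a p) =
    eventually-zip (λ s n<s → λ { (q , r) → finish s n<s q r }) (suc n , λ _ le → le)
      (eventually-zip (λ _ → _,_) (stage-complete f a)
        (eventually-∀< n λ m m<n → eventually-map (λ _ → proj₁ (p m m<n) ,_) (stage-complete f (proj₂ (p m m<n)))))
    where
    finish : ∀ s → n < s → fun (stage f) (s ∷ n ∷ xs) ≡ 1 →
      (∀ m → m < n → Σ ℕ λ v → fun (stage f) (s ∷ m ∷ xs) ≡ suc (suc v)) →
      fun (stage (mu f)) (s ∷ xs) ≡ suc n
    finish s n<s q r with y , e ← firstTo-complete s
        (λ i → (1 ∸ fun (stageFailure f) (i ∷ s ∷ xs)) * suc i) n n<s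
        (trans (cong (λ w → (1 ∸ w) * suc n) (⇒stageFailure≡0 f s xs n q r)) (+-identityʳ (suc n)))
      -- The search has found some value; soundness and determinism identify it as `n`.
      = trans e (cong suc (eval-functional (mu f) (stage-sound (mu f) s xs e) (eMu a p)))

  stage-complete-prec : ∀ {k} (g : PR k) h {n xs y} → Eval (prec g h) (n ∷ xs) y →
    Eventually λ s → recFun (stage g) (stageStep h) n (s ∷ xs) ≡ suc y
  stage-complete-prec g h (ePrec0 a) = stage-complete g a
  stage-complete-prec g h {suc n} {xs} (ePrecS {r = r} a b) = eventually-zip
    (λ s p q → trans (cong (λ v → guardℕ v (fun (stage h) (s ∷ n ∷ pred v ∷ xs))) p) q)
    (stage-complete-prec g h a) (stage-complete h b)

  stages-complete : ∀ {k m} (hs : Vec (PR k) m) {xs ys} → EvalAll hs xs ys →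
    Eventually λ s → (∀ F → fun (guardAll (stages hs) F) (s ∷ xs) ≡ fun F (s ∷ xs)) ×
                     map (λ G → fun G (s ∷ xs)) (map predᶠ (stages hs)) ≡ ys
  stages-complete [] [] = 0 , λ _ _ → (λ _ → refl) , refl
  stages-complete (h ∷ hs) {xs} (a ∷ as) = eventually-zip
    (λ s p q → (λ F → trans (cong (λ v → guardℕ v (fun (guardAll (stages hs) F) (s ∷ xs))) p) (proj₁ q F)) ,
               cong₂ _∷_ (cong pred p) (proj₂ q))
    (stage-complete h a) (stages-complete hs as)
-- Inverses, pairing and finite sequences

module Inverse (H : Fn 1) (strict : ∀ n → fun H (n ∷ []) < fun H (suc n ∷ [])) where
  private h = λ n → fun H (n ∷ [])

  -- Recursion on `z`: the value rises by one when `suc z` reaches the next value of `h`. As `h` is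
  -- strictly increasing, it never has to rise by more.
  inverse : Fn 1
  inverse = rec (lit 0) (arg #1 +ᶠ (lit 1 ∸ᶠ (ap H (sucᶠ (arg #1) ∷ []) ∸ᶠ sucᶠ (arg #0))))

  private inv = λ z → fun inverse (z ∷ [])

  h-mono : ∀ {m n} → m ≤ n → h m ≤ h n
  h-mono {m} {n} m≤n with m≤n⇒m<n∨m≡n m≤n
  ... | inj₂ refl = ≤-refl
  h-mono {m} {suc n} _ | inj₁ m<1+n = ≤-trans (h-mono (≤-pred m<1+n)) (<⇒≤ (strict n))

  -- The alternative `inv z ≡ 0` covers the `z` below `h 0`, such as 0 for `pow2`.
  inverse-bounds : ∀ z → (inv z ≡ 0 ⊎ h (inv z) ≤ z) × z < h (suc (inv z))
  inverse-bounds zero = inj₁ refl , ≤-trans (s≤s z≤n) (strict 0)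
  inverse-bounds (suc z) = go (h (suc (inv z)) ∸ suc z) refl (inverse-bounds z)
    where
    go : ∀ v → h (suc (inv z)) ∸ suc z ≡ v → (inv z ≡ 0 ⊎ h (inv z) ≤ z) × z < h (suc (inv z)) →
      (inv (suc z) ≡ 0 ⊎ h (inv (suc z)) ≤ suc z) × suc z < h (suc (inv (suc z)))
    go zero eq (_ , z<) rewrite eq | +-comm (inv z) 1 =
      inj₂ (m∸n≡0⇒m≤n eq) , ≤-<-trans z< (strict _)
    go (suc v) eq (lo , z<) rewrite eq | 0∸n≡0 v | +-identityʳ (inv z) =
      lower lo , ≰⇒> λ le → case-0 (trans (sym eq) (m≤n⇒m∸n≡0 le))
      where
      case-0 : ¬ suc v ≡ 0
      case-0 ()
      lower : inv z ≡ 0 ⊎ h (inv z) ≤ z → inv z ≡ 0 ⊎ h (inv z) ≤ suc z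
      lower (inj₁ p) = inj₁ p
      lower (inj₂ p) = inj₂ (m≤n⇒m≤1+n p)

  inverse-unique : ∀ n z → h n ≤ z → z < h (suc n) → inv z ≡ n
  inverse-unique n z lo hi with <-cmp (inv z) n | inverse-bounds z
  ... | tri≈ _ eq _ | _ = eq
  ... | tri< lt _ _ | _ , z< = ⊥-elim (<⇒≱ z< (≤-trans (h-mono lt) lo))
  ... | tri> _ _ gt | inj₂ le , _ = ⊥-elim (<⇒≱ hi (≤-trans (h-mono gt) le))
  ... | tri> _ _ gt | inj₁ eq , _ with () ← ≤-trans gt (≤-reflexive eq)

square : Fn 1
square = arg #0 *ᶠ arg #0

module Root = Inverse square (λ n → *-mono-< (n<1+n n) (n<1+n n))
module Log = Inverse pow2 (λ n → ^-monoʳ-< 2 ≤-refl (n<1+n n))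

diagonalˡ diagonalʳ : Fn 1
diagonalˡ = arg #0 ∸ᶠ ap square (Root.inverse ∷ [])
diagonalʳ = Root.inverse ∸ᶠ diagonalˡ

-- The integer square root recovers `a + b`, since `a` is less than the gap to the next square.
pair : ℕ → ℕ → ℕ
pair a b = (a + b) * (a + b) + a

root-pair : ∀ a b → fun Root.inverse (pair a b ∷ []) ≡ a + b
root-pair a b = Root.inverse-unique c (pair a b) (m≤m+n (c * c) a) (begin-strict
  c * c + a       ≤⟨ +-monoʳ-≤ (c * c) (m≤m+n a b) ⟩
  c * c + c       ≡⟨ +-comm (c * c) c ⟩
  c + c * c       ≡⟨ *-suc c c ⟨
  c * suc c       <⟨ m<n+m _ (s≤s z≤n) ⟩
  suc c * suc c   ∎)
  where
  open ≤-Reasoning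
  c = a + b

-- Abstract, since unfolding the decoding functions makes conversion checking very slow.
abstract
  πˡ πʳ lg : ℕ → ℕ
  πˡ z = fun diagonalˡ (z ∷ [])
  πʳ z = fun diagonalʳ (z ∷ [])
  lg z = fun Log.inverse (z ∷ [])

  πˡ-fun : ∀ xs → fun diagonalˡ xs ≡ πˡ (lookup xs #0)
  πˡ-fun (z ∷ []) = refl

  πʳ-fun : ∀ xs → fun diagonalʳ xs ≡ πʳ (lookup xs #0)
  πʳ-fun (z ∷ []) = refl

  lg-fun : ∀ xs → fun Log.inverse xs ≡ lg (lookup xs #0)
  lg-fun (z ∷ []) = refl

  πˡ-pair : ∀ a b → πˡ (pair a b) ≡ a
  πˡ-pair a b rewrite root-pair a b = m+n∸m≡n ((a + b) * (a + b)) a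

  πʳ-pair : ∀ a b → πʳ (pair a b) ≡ b
  πʳ-pair a b = trans (cong₂ _∸_ (root-pair a b) (πˡ-pair a b)) (m+n∸m≡n a b)

  lg-unique : ∀ n z → 2 ^ n ≤ z → z < 2 ^ suc n → lg z ≡ n
  lg-unique = Log.inverse-unique

πˡᶠ πʳᶠ lgᶠ : ∀ {k} → Fn k → Fn k
πˡᶠ F = ap (recast diagonalˡ (λ xs → πˡ (lookup xs #0)) πˡ-fun) (F ∷ [])
πʳᶠ F = ap (recast diagonalʳ (λ xs → πʳ (lookup xs #0)) πʳ-fun) (F ∷ [])
lgᶠ F = ap (recast Log.inverse (λ xs → lg (lookup xs #0)) lg-fun) (F ∷ [])

-- Plays the part of Gödel's beta function, with nested pairs in place of remainders; the code
-- stores no length.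
β : ℕ → ℕ → ℕ
β z zero = πˡ z
β z (suc r) = β (πʳ z) r

entry : Fn 2
entry = recast (πˡᶠ (ap tails (arg #1 ∷ arg #0 ∷ []))) (λ xs → β (lookup xs #0) (lookup xs #1))
    λ { (z ∷ r ∷ []) → eq r z }
  where
  tails : Fn 2
  tails = rec (arg #0) (πʳᶠ (arg #1))
  shift : ∀ r z → fun tails (suc r ∷ z ∷ []) ≡ fun tails (r ∷ πʳ z ∷ [])
  shift zero z = refl
  shift (suc r) z = cong πʳ (shift r z)
  eq : ∀ r z → πˡ (fun tails (r ∷ z ∷ [])) ≡ β z r
  eq zero z = refl
  eq (suc r) z = trans (cong πˡ (shift r z)) (eq r (πʳ z))

βᶠ : ∀ {k} → Fn k → Fn k → Fn k
βᶠ F G = ap entry (F ∷ G ∷ [])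

encode : ∀ m (a : ℕ → ℕ) → Σ ℕ λ z → ∀ r → r < m → β z r ≡ a r
encode zero a = 0 , λ _ ()
encode (suc m) a with z , p ← encode m (a ∘ suc) = pair (a 0) z , decode
  where
  decode : ∀ r → r < suc m → β (pair (a 0) z) r ≡ a r
  decode zero _ = πˡ-pair (a 0) z
  decode (suc r) (s≤s r<m) = trans (cong (λ w → β w r) (πʳ-pair (a 0) z)) (p r r<m)

least : ∀ n (a : ℕ → ℕ) → a n ≡ 0 → Σ ℕ λ m → a m ≡ 0 × (∀ i → i < m → Σ ℕ λ v → a i ≡ suc v)
least zero a eq = 0 , eq , λ _ ()
least (suc n) a eq with a 0 in eq₀
... | zero = 0 , eq₀ , λ _ ()
... | suc v with m , p , q ← least n (a ∘ suc) eq = suc m , p , below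
  where
  below : ∀ i → i < suc m → Σ ℕ λ v → a i ≡ suc v
  below zero _ = v , eq₀
  below (suc i) (s≤s i<m) = q i i<m

-- As `F` is total, any zero makes the search halt, though possibly at a smaller zero than the given
-- one.
mu-complete : ∀ {k} (F : Fn (suc k)) xs n → fun F (n ∷ xs) ≡ 0 →
  Σ ℕ λ m → fun F (m ∷ xs) ≡ 0 × Eval (mu (code F)) xs m
mu-complete F xs n eq with m , p , q ← least n (λ i → fun F (i ∷ xs)) eq =
  m , p , eMu (subst (Eval (code F) (m ∷ xs)) p (sound F _))
              λ i i<m → proj₁ (q i i<m) , subst (Eval (code F) (i ∷ xs)) (proj₂ (q i i<m)) (sound F _)

-- Indices of the functions listed by a partial recursive G

-- The Kolmogorov property is applied to the numbering whose `e`-th function is that of φ-index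
-- `G e`: its translation `t e` is an index of the same function, so the minimal one is no larger.
min-index-of-enumerated : ∀ φ → Kolmogorov φ → (G : PR 1) →
  Σ ℕ λ c → ∀ e v j → Eval G (e ∷ []) v → IsMinIndex φ v j → j ≤ c * e + c
min-index-of-enumerated φ kol G with c , _ , t , p ← kol (comp φ (comp G (P #0 ∷ []) ∷ P #1 ∷ [])) =
  c , λ e v j ev (same , minimal) → ≤-trans (≮⇒≥ λ te<j → minimal (t e) te<j λ x y → mk⇔
      (λ a → from-ψ e v x y ev (Equivalence.to (proj₂ (p e) x y) a))
      (λ a → Equivalence.from (proj₂ (p e) x y) (eComp (eComp (eP ∷ []) ev ∷ eP ∷ []) a)))
    (proj₁ (p e))
  where
  from-ψ : ∀ e v x y → Eval G (e ∷ []) v →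
    Eval (comp φ (comp G (P #0 ∷ []) ∷ P #1 ∷ [])) (e ∷ x ∷ []) y → Eval φ (v ∷ x ∷ []) y
  from-ψ e v x y ev (eComp (eComp (eP ∷ []) ev′ ∷ eP ∷ []) a)
    with refl ← eval-functional G ev ev′ = a
-- Certificates

-- Block parameters at level k: with j = lg k and C = πˡ j, the indices in [lo k , hi k) are cut
-- into 2 ^ j blocks of width k, of which dep k may be used.
C lo hi width dep : ℕ → ℕ
C k = πˡ (lg k)
lo k = 2 ^ (k ∸ 2)
hi k = 2 ^ (k + C k)
width k = 2 ^ (k + C k ∸ lg k)
dep k = 2 ^ (lg k ∸ C k ∸ 1)

Cᶠ loᶠ hiᶠ widthᶠ depᶠ : ∀ {k} → Fn k → Fn k
Cᶠ F = πˡᶠ (lgᶠ F)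
loᶠ F = 2^ᶠ (F ∸ᶠ lit 2)
hiᶠ F = 2^ᶠ (F +ᶠ Cᶠ F)
widthᶠ F = 2^ᶠ (F +ᶠ Cᶠ F ∸ᶠ lgᶠ F)
depᶠ F = 2^ᶠ (lgᶠ F ∸ᶠ Cᶠ F ∸ᶠ lit 1)

point : ℕ → ℕ → ℕ
point z r = β (β z 1) r

blocks : ℕ → ℕ → ℕ
blocks z = β (β z 2)

start : ℕ → (ℕ → ℕ) → ℕ → ℕ
start k τ t = τ t * width k

-- Entries from `hi k` on are harmless, because the minimal indices to be counted lie below `hi k`.
Covered : ℕ → (ℕ → ℕ) → ℕ → Set
Covered k τ p =
  (p < lo k ⊎ hi k ≤ p) ⊎ Σ ℕ λ t → t < dep k × (start k τ t ≤ p) × (p < start k τ t + width k)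

-- Truth is coded by 0, so products express disjunctions and existence, and sums express
-- conjunctions.
outsideBlocks outside : Fn 3
outside = (sucᶠ (arg #0) ∸ᶠ loᶠ (arg #2)) *ᶠ ((hiᶠ (arg #2) ∸ᶠ arg #0) *ᶠ outsideBlocks)
outsideBlocks =
  ∏ (depᶠ (arg #2)) ((s ∸ᶠ arg #1) +ᶠ (sucᶠ (arg #1) ∸ᶠ (s +ᶠ widthᶠ (arg #3))))
  where s = βᶠ (βᶠ (arg #2) (lit 2)) (arg #0) *ᶠ widthᶠ (arg #3)

outside≡0⇒ : ∀ p z k → fun outside (p ∷ z ∷ k ∷ []) ≡ 0 → Covered k (blocks z) p
outside≡0⇒ p z k eq with m*n≡0⇒m≡0∨n≡0 (suc p ∸ lo k) eq
... | inj₁ a = inj₁ (inj₁ (m∸n≡0⇒m≤n a))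
... | inj₂ eq with m*n≡0⇒m≡0∨n≡0 (hi k ∸ p) eq
...   | inj₁ a = inj₁ (inj₂ (m∸n≡0⇒m≤n a))
...   | inj₂ eq with t , t<d , a ← prodTo≡0⇒ (dep k) _ eq =
  inj₂ (t , t<d , m∸n≡0⇒m≤n (m+n≡0⇒m≡0 (start k (blocks z) t ∸ p) a) ,
                  m∸n≡0⇒m≤n (m+n≡0⇒n≡0 (start k (blocks z) t ∸ p) a))

⇒outside≡0 : ∀ p z k → Covered k (blocks z) p → fun outside (p ∷ z ∷ k ∷ []) ≡ 0
⇒outside≡0 p z k cov = go cov
  where
  a = suc p ∸ lo k
  b = hi k ∸ p
  c = fun outsideBlocks (p ∷ z ∷ k ∷ [])
  go : Covered k (blocks z) p → a * (b * c) ≡ 0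
  go (inj₁ (inj₁ p<lo)) = cong (_* (b * c)) (m≤n⇒m∸n≡0 p<lo)
  go (inj₁ (inj₂ hi≤p)) = trans (cong (λ v → a * (v * c)) (m≤n⇒m∸n≡0 hi≤p)) (*-zeroʳ a)
  go (inj₂ (t , t<d , s≤p , p<)) =
    trans (cong (λ v → a * (b * v)) (⇒prodTo≡0 (dep k) _ t t<d (cong₂ _+_ (m≤n⇒m∸n≡0 s≤p) (m≤n⇒m∸n≡0 p<))))
          (trans (cong (a *_) (*-zeroʳ b)) (*-zeroʳ a))

≢⇒1∸distance≡0 : ∀ {m n} → m ≢ n → 1 ∸ ((m ∸ n) + (n ∸ m)) ≡ 0
≢⇒1∸distance≡0 {m} {n} m≢n with (m ∸ n) + (n ∸ m) in eq
... | suc v = 0∸n≡0 v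
... | zero = ⊥-elim (m≢n (≤-antisym (m∸n≡0⇒m≤n (m+n≡0⇒m≡0 (m ∸ n) eq))
                                    (m∸n≡0⇒m≤n (m+n≡0⇒n≡0 (m ∸ n) eq))))

distance-refl : ∀ n → (n ∸ n) + (n ∸ n) ≡ 0
distance-refl n = cong₂ _+_ (n∸n≡0 n) (n∸n≡0 n)

-- A certificate z of level k codes a number of stages (β z 0), 2 ^ k points (β z 1) whose
-- functions are seen to differ at 0, and blocks (β z 2) such that every entry of f at a point is
-- below lo k, at least hi k, or in one of the blocks.  If all the points had minimal indices below
-- hi k, these would be 2 ^ k different numbers in lo k + dep k * width k < 2 ^ k places.
module Certificates (φ : Numbering) (f : ℕ → List ℕ) (L : PR 1) (H : PR 2)
  (L-eval : ∀ x → Eval L (x ∷ []) (length (f x)))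
  (H-eval : ∀ x (i : Fin (length (f x))) → Eval H (x ∷ toℕ i ∷ []) (Data.List.lookup (f x) i))
  where

  lengthᶠ : Fn 1
  lengthᶠ .fun xs = length (f (lookup xs #0))
  lengthᶠ .code = L
  lengthᶠ .sound (x ∷ []) = L-eval x

  pointᶠ : Fn 2
  pointᶠ = βᶠ (βᶠ (arg #0) (lit 1)) (arg #1)

  valueᶠ : Fn 2
  valueᶠ = ap (stage φ) (βᶠ (arg #0) (lit 0) ∷ pointᶠ ∷ lit 0 ∷ [])

  listedᶠ : Fn 3
  listedᶠ = ap (stage H) (βᶠ (arg #0) (lit 0) ∷ ap pointᶠ (arg #0 ∷ arg #1 ∷ []) ∷ arg #2 ∷ [])

  value : ℕ → ℕ → ℕ
  value z r = fun (stage φ) (β z 0 ∷ point z r ∷ 0 ∷ [])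

  listed : ℕ → ℕ → ℕ → ℕ
  listed z r i = fun (stage H) (β z 0 ∷ point z r ∷ i ∷ [])

  coincidence : Fn 3
  coincidence = lit 1 ∸ᶠ ((v ∸ᶠ v′) +ᶠ (v′ ∸ᶠ v))
    where
    v = ap valueᶠ (arg #2 ∷ arg #1 ∷ [])
    v′ = ap valueᶠ (arg #2 ∷ arg #0 ∷ [])

  escape : Fn 4
  escape = (lit 1 ∸ᶠ p) +ᶠ ap outside (predᶠ p ∷ arg #2 ∷ arg #3 ∷ [])
    where p = ap listedᶠ (arg #2 ∷ arg #1 ∷ arg #0 ∷ [])

  -- The three summands match the three fields of `IsCertificate` at one point.
  defect : Fn 3
  defect =
    (lit 1 ∸ᶠ ap valueᶠ (arg #1 ∷ arg #0 ∷ [])) +ᶠ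
    (∑ (arg #0) (ap coincidence (arg #0 ∷ arg #1 ∷ arg #2 ∷ [])) +ᶠ
     ∑ (ap lengthᶠ (ap pointᶠ (arg #1 ∷ arg #0 ∷ []) ∷ [])) escape)

  failure : Fn 2
  failure = ∑ (2^ᶠ (arg #1)) defect

  record IsCertificate (k z : ℕ) : Set where
    field
      converges : ∀ r → r < 2 ^ k → value z r ≡ suc (pred (value z r))
      distinct  : ∀ r r′ → r < 2 ^ k → r′ < r → value z r ≢ value z r′
      covered   : ∀ r i → r < 2 ^ k → i < length (f (point z r)) →
                  listed z r i ≡ suc (pred (listed z r i)) × Covered k (blocks z) (pred (listed z r i))

  failure≡0⇒ : ∀ k z → fun failure (z ∷ k ∷ []) ≡ 0 → IsCertificate k z
  failure≡0⇒ k z eq = record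
    { converges = λ r r< → 1∸v≡0⇒v≡suc (value z r) (m+n≡0⇒m≡0 (1 ∸ value z r) (at r r<))
    ; distinct = λ r r′ r< r′<r same → 1≢0 (trans
        (cong (1 ∸_) (sym (trans (cong (λ v → (value z r ∸ v) + (v ∸ value z r)) (sym same)) (distance-refl (value z r)))))
        (sumTo≡0⇒ r _ (m+n≡0⇒m≡0 (sumTo r _) (rest r r<)) r′ r′<r))
    ; covered = λ r i r< i< → let e = sumTo≡0⇒ (length (f (point z r))) _ (m+n≡0⇒n≡0 (sumTo r _) (rest r r<)) i i< in
        1∸v≡0⇒v≡suc (listed z r i) (m+n≡0⇒m≡0 (1 ∸ listed z r i) e) ,
        outside≡0⇒ (pred (listed z r i)) z k (m+n≡0⇒n≡0 (1 ∸ listed z r i) e) }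
    where
    at : ∀ r → r < 2 ^ k → fun defect (r ∷ z ∷ k ∷ []) ≡ 0
    at = sumTo≡0⇒ (2 ^ k) _ eq
    rest = λ r r< → m+n≡0⇒n≡0 (1 ∸ value z r) (at r r<)
    1≢0 : 1 ≢ 0
    1≢0 ()

  ⇒failure≡0 : ∀ k z → IsCertificate k z → fun failure (z ∷ k ∷ []) ≡ 0
  ⇒failure≡0 k z cert = ⇒sumTo≡0 (2 ^ k) _ λ r r< →
    cong₂ _+_ (1∸ (converges r r<)) (cong₂ _+_
      (⇒sumTo≡0 r _ λ r′ r′<r → ≢⇒1∸distance≡0 (distinct r r′ r< r′<r))
      (⇒sumTo≡0 (length (f (point z r))) _ λ i i< → let a , b = covered r i r< i< in
        cong₂ _+_ (1∸ a) (⇒outside≡0 (pred (listed z r i)) z k b)))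
    where
    open IsCertificate cert
    1∸ : ∀ {v w} → v ≡ suc w → 1 ∸ v ≡ 0
    1∸ {w = w} refl = 0∸n≡0 w

  listed-sound : ∀ {z r p} (i : Fin (length (f (point z r)))) → listed z r (toℕ i) ≡ suc p →
    Data.List.lookup (f (point z r)) i ≡ p
  listed-sound i eq = eval-functional H (H-eval _ i) (stage-sound H _ _ eq)

  module _ (lists-min : ∀ x → Σ ℕ λ j → IsMinIndex φ x j × j ∈ f x) where

    -- Pigeonhole on minimal indices: two points in one slot share their minimal index, hence their
    -- function, against their different values at 0.
    no-certificate : ∀ k z → IsCertificate k z → lo k + dep k * width k < 2 ^ k →
      (∀ r j → r < 2 ^ k → IsMinIndex φ (point z r) j → j < hi k) → ⊥
    no-certificate k z cert room below-hi =
      let r , r′ , r<r′ , same = pigeonhole room (λ r → slot (place r))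
          j≡j′ = trans (sym (unslot-slot (place r))) (trans (cong unslot same) (unslot-slot (place r′)))
      in distinct (toℕ r′) (toℕ r) (toℕ<n r′) r<r′ (values-agree r′ r (sym j≡j′))
      where
      open IsCertificate cert

      index-of : Fin (2 ^ k) → ℕ
      index-of r = proj₁ (lists-min (point z (toℕ r)))

      isMin : ∀ r → IsMinIndex φ (point z (toℕ r)) (index-of r)
      isMin r = proj₁ (proj₂ (lists-min (point z (toℕ r))))

      Place : ℕ → Set
      Place p = p < lo k ⊎ Σ ℕ λ t → t < dep k × (start k (blocks z) t ≤ p) × (p < start k (blocks z) t + width k)

      covered-at : ∀ r → Covered k (blocks z) (index-of r)
      covered-at r =
        let j∈ = proj₂ (proj₂ (lists-min (point z (toℕ r))))
            a , b = covered (toℕ r) (toℕ (index j∈)) (toℕ<n r) (toℕ<n (index j∈))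
        in subst (Covered k (blocks z))
             (trans (sym (listed-sound {z} {toℕ r} (index j∈) a)) (sym (lookup-index j∈))) b

      place : ∀ r → Place (index-of r)
      place r with covered-at r
      ... | inj₁ (inj₁ a) = inj₁ a
      ... | inj₁ (inj₂ hi≤) = ⊥-elim (<⇒≱ (below-hi (toℕ r) _ (toℕ<n r) (isMin r)) hi≤)
      ... | inj₂ b = inj₂ b

      slot : ∀ {p} → Place p → Fin (lo k + dep k * width k)
      slot (inj₁ p<lo) = fromℕ< p<lo ↑ˡ (dep k * width k)
      slot {p} (inj₂ (t , t<d , s≤p , p<)) = lo k ↑ʳ combine (fromℕ< t<d)
        (fromℕ< (+-cancelˡ-< (start k (blocks z) t) _ _ (subst (_< start k (blocks z) t + width k) (sym (m+[n∸m]≡n s≤p)) p<)))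

      -- Recovers the number from its slot, so that equal slots force equal minimal indices even
      -- where blocks overlap.
      unslot : Fin (lo k + dep k * width k) → ℕ
      unslot q = [ toℕ , (λ q′ → let t , u = remQuot {dep k} (width k) q′ in start k (blocks z) (toℕ t) + toℕ u) ]′
        (splitAt (lo k) q)

      unslot-slot : ∀ {p} (a : Place p) → unslot (slot a) ≡ p
      unslot-slot (inj₁ p<lo) rewrite splitAt-↑ˡ (lo k) (fromℕ< p<lo) (dep k * width k) = toℕ-fromℕ< p<lo
      unslot-slot {p} (inj₂ (t , t<d , s≤p , p<)) = trans
        (cong [ toℕ , _ ]′ (splitAt-↑ʳ (lo k) (dep k * width k) _))
        (trans (cong (λ (t , u) → start k (blocks z) (toℕ t) + toℕ u) (remQuot-combine (fromℕ< t<d) _))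
        (trans (cong₂ (λ t u → start k (blocks z) t + u) (toℕ-fromℕ< t<d) (toℕ-fromℕ< _)) (m+[n∸m]≡n s≤p)))

      values-agree : ∀ r r′ → index-of r ≡ index-of r′ → value z (toℕ r) ≡ value z (toℕ r′)
      values-agree r r′ eq = trans cr (trans (cong suc (eval-functional φ (stage-sound φ _ _ cr)
          (Equivalence.to (proj₁ (isMin r) 0 _) (subst (λ j → Eval φ (j ∷ 0 ∷ []) _) (sym eq)
            (Equivalence.from (proj₁ (isMin r′) 0 _) (stage-sound φ _ _ cr′)))))) (sym cr′))
        where
        cr = converges (toℕ r) (toℕ<n r)
        cr′ = converges (toℕ r′) (toℕ<n r′)

-- Selecting sublists

-- Total, as `encode` takes functions on ℕ. The default 0 also pads a short list of blocks; extra
-- blocks only cover more.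
nth : List ℕ → ℕ → ℕ
nth [] i = 0
nth (a ∷ as) zero = a
nth (a ∷ as) (suc i) = nth as i

nth-toℕ : ∀ as (i : Fin (length as)) → nth as (toℕ i) ≡ Data.List.lookup as i
nth-toℕ (a ∷ as) zero = refl
nth-toℕ (a ∷ as) (suc i) = nth-toℕ as i

nth-∈ : ∀ as {i} → i < length as → nth as i ∈ as
nth-∈ (a ∷ as) {zero} _ = here refl
nth-∈ (a ∷ as) {suc i} (s≤s i<) = there (nth-∈ as i<)

nth-distinct : ∀ {as} → Unique as → ∀ i j → i < length as → j < i → nth as i ≢ nth as j
nth-distinct {a ∷ as} (ne ∷ _) (suc i) zero (s≤s i<) _ eq = All.lookup ne (nth-∈ as i<) (sym eq)
nth-distinct {a ∷ as} (_ ∷ u) (suc i) (suc j) (s≤s i<) (s≤s j<i) = nth-distinct u i j i< j<i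

module _ {A : ℕ → Set} (A? : ∀ a → Dec (A a)) where
  length-split : ∀ as → length as ≡ length (filter A? as) + length (filter (¬? ∘ A?) as)
  length-split [] = refl
  length-split (a ∷ as) with A? a
  ... | yes _ = cong suc (length-split as)
  ... | no _ = trans (cong suc (length-split as)) (sym (+-suc _ _))

  halve : ∀ b as → 2 * b ≤ length as →
    b ≤ length (filter A? as) ⊎ b ≤ length (filter (¬? ∘ A?) as)
  halve b as le with b ≤? length (filter A? as)
  ... | yes p = inj₁ p
  ... | no p = inj₂ (+-cancelˡ-≤ b _ _ (begin
    b + b            ≡⟨ cong (b +_) (+-identityʳ b) ⟨
    2 * b            ≤⟨ le ⟩
    length as        ≡⟨ length-split as ⟩
    length (filter A? as) + length (filter (¬? ∘ A?) as)  ≤⟨ +-monoˡ-≤ _ (<⇒≤ (≰⇒> p)) ⟩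
    b + length (filter (¬? ∘ A?) as) ∎))
    where open ≤-Reasoning

-- Q successive bisections; sublists are given only by their elements.
homogenize : ∀ Q {A : ℕ → ℕ → Set} (A? : ∀ q a → Dec (A q a)) b as →
  Unique as → 2 ^ Q * b ≤ length as →
  Σ (List ℕ) λ bs → Unique bs × (∀ {a} → a ∈ bs → a ∈ as) × b ≤ length bs ×
    (∀ q → q < Q → ∀ {a a′} → a ∈ bs → a′ ∈ bs → A q a → A q a′)
homogenize zero A? b as u le = as , u , (λ a∈ → a∈) , ≤-trans (m≤m+n b 0) le , λ _ ()
homogenize (suc Q) {A} A? b as u le with halve (A? Q) (2 ^ Q * b) as (≤-trans (≤-reflexive (sym (*-assoc 2 (2 ^ Q) b))) le)
... | inj₁ half with bs , v , sub , le′ , hom ← homogenize Q A? b _ (filter⁺ (A? Q) u) half =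
  bs , v , proj₁ ∘ ∈-filter⁻ (A? Q) ∘ sub , le′ ,
  λ q q<1+Q → cases q (m≤n⇒m<n∨m≡n (≤-pred q<1+Q))
  where
  cases : ∀ q → q < Q ⊎ q ≡ Q → ∀ {a a′} → a ∈ bs → a′ ∈ bs → A q a → A q a′
  cases q (inj₁ q<Q) = hom q q<Q
  cases q (inj₂ refl) _ a′∈ _ = proj₂ (∈-filter⁻ (A? Q) {xs = as} (sub a′∈))
... | inj₂ half with bs , v , sub , le′ , hom ← homogenize Q A? b _ (filter⁺ (¬? ∘ A? Q) u) half =
  bs , v , proj₁ ∘ ∈-filter⁻ (¬? ∘ A? Q) ∘ sub , le′ ,
  λ q q<1+Q → cases q (m≤n⇒m<n∨m≡n (≤-pred q<1+Q))
  where
  cases : ∀ q → q < Q ⊎ q ≡ Q → ∀ {a a′} → a ∈ bs → a′ ∈ bs → A q a → A q a′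
  cases q (inj₁ q<Q) = hom q q<Q
  cases q (inj₂ refl) a∈ _ Aa = ⊥-elim (proj₂ (∈-filter⁻ (¬? ∘ A? Q) {xs = as} (sub a∈)) Aa)

-- Counting list entries in disjoint intervals

Within : ℕ → ℕ → ℕ → Set
Within a b p = (a ≤ p) × (p < b)

within? : ∀ a b p → Dec (Within a b p)
within? a b p = (a ≤? p) ×-dec (p <? b)

count : ℕ → ℕ → List ℕ → ℕ
count a b ps = length (filter (within? a b) ps)

length-filter-disjoint : ∀ {A B C : ℕ → Set}
  (A? : ∀ a → Dec (A a)) (B? : ∀ a → Dec (B a)) (C? : ∀ a → Dec (C a)) →
  (∀ a → A a → ¬ B a) → (∀ a → A a → C a) → (∀ a → B a → C a) →
  ∀ as → length (filter A? as) + length (filter B? as) ≤ length (filter C? as)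
length-filter-disjoint A? B? C? ab ac bc [] = z≤n
length-filter-disjoint A? B? C? ab ac bc (p ∷ ps)
  with ih ← length-filter-disjoint A? B? C? ab ac bc ps | A? p | B? p | C? p
... | yes a | yes b | _ = ⊥-elim (ab p a b)
... | yes a | no _ | no ¬c = ⊥-elim (¬c (ac p a))
... | no _ | yes b | no ¬c = ⊥-elim (¬c (bc p b))
... | yes _ | no _ | yes _ = s≤s ih
... | no _ | yes _ | yes _ = ≤-trans (≤-reflexive (+-suc _ _)) (s≤s ih)
... | no _ | no _ | yes _ = m≤n⇒m≤1+n ih
... | no _ | no _ | no _ = ih

count-adjacent : ∀ {a b c} → a ≤ b → b ≤ c → ∀ ps → count a b ps + count b c ps ≤ count a c ps
count-adjacent a≤b b≤c = length-filter-disjoint (within? _ _) (within? _ _) (within? _ _)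
  (λ p (_ , p<b) (b≤p , _) → <⇒≱ p<b b≤p)
  (λ p (a≤p , p<b) → a≤p , <-≤-trans p<b b≤c)
  (λ p (b≤p , p<c) → ≤-trans a≤b b≤p , p<c)

counts-bound : ∀ (θ : ℕ → ℕ) → (∀ i → θ i ≤ θ (suc i)) → ∀ d ps m →
  (∀ i → i < m → d < count (θ i) (θ (suc i)) ps) → m * suc d ≤ count (θ 0) (θ m) ps
counts-bound θ mono d ps zero big = z≤n
counts-bound θ mono d ps (suc m) big = begin
  suc d + m * suc d                                          ≡⟨ +-comm (suc d) (m * suc d) ⟩
  m * suc d + suc d                                          ≤⟨ +-mono-≤ (counts-bound θ mono d ps m λ i i<m → big i (m<n⇒m<1+n i<m)) (big m ≤-refl) ⟩
  count (θ 0) (θ m) ps + count (θ m) (θ (suc m)) ps          ≤⟨ count-adjacent (from-0 m) (mono m) ps ⟩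
  count (θ 0) (θ (suc m)) ps                                 ∎
  where
  open ≤-Reasoning
  from-0 : ∀ i → θ 0 ≤ θ i
  from-0 zero = ≤-refl
  from-0 (suc i) = ≤-trans (from-0 i) (mono i)

-- If each of the `m` disjoint intervals held more than `d` entries, the list would have at least
-- `m * suc d`.
sparse-level : ∀ (θ : ℕ → ℕ) → (∀ i → θ i ≤ θ (suc i)) → ∀ d ps m →
  length ps < m * suc d → Σ ℕ λ i → i < m × count (θ i) (θ (suc i)) ps ≤ d
sparse-level θ mono d ps m short with anyUpTo? (λ i → count (θ i) (θ (suc i)) ps ≤? d) m
... | yes p = p
... | no none = ⊥-elim (<⇒≱ short (≤-trans
    (counts-bound θ mono d ps m λ i i<m → ≰⇒> λ le → none (i , i<m , le))
    (length-filter (within? (θ 0) (θ m)) ps)))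

-- Levels and the arithmetic of their blocks

n<2^n : ∀ n → n < 2 ^ n
n<2^n zero = s≤s z≤n
n<2^n (suc n) = begin-strict
  suc n             ≤⟨ n<2^n n ⟩
  2 ^ n             <⟨ m<m+n (2 ^ n) (≤-trans (m^n>0 2 n) (m≤m+n (2 ^ n) 0)) ⟩
  2 ^ suc n         ∎
  where open ≤-Reasoning

-- The levels 2 ^ j + i 2 ^ (1 + c) for i < 2 ^ a, where j = 1 + c + a, lie in [2 ^ j , 2 ^ (1 + j)),
-- and are so far apart that their index ranges [lo k , hi k) are disjoint.
module Levels (c a : ℕ) (πˡ-c : πˡ (suc c + a) ≡ c) where
  j : ℕ
  j = suc c + a

  level θ : ℕ → ℕ
  level i = 2 ^ j + i * 2 ^ suc c
  θ i = lo (level i)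

  θ-mono : ∀ i → θ i ≤ θ (suc i)
  θ-mono i = ^-monoʳ-≤ 2 (∸-monoˡ-≤ 2 (+-monoʳ-≤ (2 ^ j) (*-monoˡ-≤ (2 ^ suc c) (n≤1+n i))))

  module _ {i : ℕ} (i<2^a : i < 2 ^ a) where
    private k = level i

    level-≥ : 2 ^ j ≤ k
    level-≥ = m≤m+n (2 ^ j) _

    level-< : k < 2 ^ suc j
    level-< = +-monoʳ-< (2 ^ j) (begin-strict
      i * 2 ^ suc c          <⟨ *-monoˡ-< (2 ^ suc c) {{m^n≢0 2 (suc c)}} i<2^a ⟩
      2 ^ a * 2 ^ suc c      ≡⟨ *-comm (2 ^ a) (2 ^ suc c) ⟩
      2 ^ suc c * 2 ^ a      ≡⟨ ^-distribˡ-+-* 2 (suc c) a ⟨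
      2 ^ j                  ≡⟨ +-identityʳ (2 ^ j) ⟨
      2 ^ j + 0              ∎)
      where open ≤-Reasoning

    lg-level : lg k ≡ j
    lg-level = lg-unique j k level-≥ level-<

    C-level : C k ≡ c
    C-level = trans (cong πˡ lg-level) πˡ-c

    dep-level : dep k ≡ 2 ^ a
    dep-level = cong (2 ^_) (begin
      lg k ∸ C k ∸ 1       ≡⟨ cong₂ (λ u v → u ∸ v ∸ 1) lg-level C-level ⟩
      suc (c + a) ∸ c ∸ 1  ≡⟨ cong (λ u → u ∸ c ∸ 1) (+-suc c a) ⟨
      c + suc a ∸ c ∸ 1    ≡⟨ cong (_∸ 1) (m+n∸m≡n c (suc a)) ⟩
      a                    ∎)
      where open ≡-Reasoning

    j≤k+C : j ≤ k + C k
    j≤k+C = ≤-trans (<⇒≤ (n<2^n j)) (≤-trans level-≥ (m≤m+n k (C k)))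

    -- Hence an index below `hi k` has a block number below `2 ^ j`, so `2 ^ j` bits record which
    -- blocks are met.
    hi-level : hi k ≡ 2 ^ j * width k
    hi-level = begin
      2 ^ (k + C k)                      ≡⟨ cong (2 ^_) (m+[n∸m]≡n j≤k+C) ⟨
      2 ^ (j + (k + C k ∸ j))            ≡⟨ ^-distribˡ-+-* 2 j (k + C k ∸ j) ⟩
      2 ^ j * 2 ^ (k + C k ∸ j)          ≡⟨ cong (λ u → 2 ^ j * 2 ^ (k + C k ∸ u)) lg-level ⟨
      2 ^ j * width k                    ∎
      where open ≡-Reasoning

    -- Consecutive levels differ by `2 ^ suc c`, which is at least `c + 2`: enough for the `c` in
    -- the exponent of `hi` and the 2 in that of `lo`.
    hi≤θ : hi k ≤ θ (suc i)
    hi≤θ = ^-monoʳ-≤ 2 (m+n≤o⇒m≤o∸n (k + C k) (begin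
      k + C k + 2                        ≡⟨ cong (λ u → k + u + 2) C-level ⟩
      k + c + 2                          ≡⟨ +-assoc k c 2 ⟩
      k + (c + 2)                        ≤⟨ +-monoʳ-≤ k (≤-trans (≤-reflexive (+-comm c 2)) (n<2^n (suc c))) ⟩
      k + 2 ^ suc c                      ≡⟨ +-assoc (2 ^ j) (i * 2 ^ suc c) (2 ^ suc c) ⟩
      2 ^ j + (i * 2 ^ suc c + 2 ^ suc c) ≡⟨ cong (2 ^ j +_) (+-comm (i * 2 ^ suc c) (2 ^ suc c)) ⟩
      level (suc i)                      ∎))
      where open ≤-Reasoning

    -- Since `j = suc c + a`, the blocks contain `2 ^ (k ∸ 1)` numbers; with the `2 ^ (k ∸ 2)` below
    -- `lo k` this is three quarters of `2 ^ k`.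
    room : lo k + dep k * width k < 2 ^ k
    room = begin-strict
      2 ^ (k ∸ 2) + dep k * width k                   ≡⟨ cong₂ (λ u v → 2 ^ (k ∸ 2) + u * 2 ^ v) dep-level (cong₂ (λ u v → k + u ∸ v) C-level lg-level) ⟩
      2 ^ (k ∸ 2) + 2 ^ a * 2 ^ (k + c ∸ j)           ≡⟨ cong (2 ^ (k ∸ 2) +_) (^-distribˡ-+-* 2 a (k + c ∸ j)) ⟨
      2 ^ (k ∸ 2) + 2 ^ (a + (k + c ∸ j))             ≡⟨ cong (λ u → 2 ^ (k ∸ 2) + 2 ^ u) exponent ⟩
      2 ^ (k ∸ 2) + 2 ^ suc (k ∸ 2)                   <⟨ +-monoˡ-< _ (^-monoʳ-< 2 ≤-refl (n<1+n (k ∸ 2))) ⟩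
      2 ^ suc (k ∸ 2) + 2 ^ suc (k ∸ 2)               ≡⟨ cong (2 ^ suc (k ∸ 2) +_) (+-identityʳ _) ⟨
      2 ^ suc (suc (k ∸ 2))                           ≡⟨ cong (2 ^_) 2+ ⟩
      2 ^ k                                           ∎
      where
      open ≤-Reasoning
      2≤k : 2 ≤ k
      2≤k = ≤-trans (s≤s (s≤s z≤n)) (≤-trans (n<2^n j) level-≥)
      2+ : suc (suc (k ∸ 2)) ≡ k
      2+ = m+[n∸m]≡n 2≤k
      exponent : a + (k + c ∸ j) ≡ suc (k ∸ 2)
      exponent = +-cancelˡ-≡ (suc c) _ _ (begin-equality
        suc c + (a + (k + c ∸ j))     ≡⟨ +-assoc (suc c) a (k + c ∸ j) ⟨
        j + (k + c ∸ j)               ≡⟨ m+[n∸m]≡n (≤-trans (<⇒≤ (n<2^n j)) (≤-trans level-≥ (m≤m+n k c))) ⟩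
        k + c                         ≡⟨ cong (_+ c) 2+ ⟨
        suc (suc (k ∸ 2)) + c         ≡⟨ cong suc (+-comm (suc (k ∸ 2)) c) ⟩
        suc c + suc (k ∸ 2)           ∎)

-- Existence of certificates

module Existence (φ : Numbering) (f : ℕ → List ℕ) (L : PR 1) (H : PR 2)
  (L-eval : ∀ x → Eval L (x ∷ []) (length (f x)))
  (H-eval : ∀ x (i : Fin (length (f x))) → Eval H (x ∷ toℕ i ∷ []) (Data.List.lookup (f x) i))
  where
  open Certificates φ f L H L-eval H-eval

  H-nth : ∀ x i → i < length (f x) → Eval H (x ∷ i ∷ []) (nth (f x) i)
  H-nth x i i< = subst₂ (λ u v → Eval H (x ∷ u ∷ []) v) (toℕ-fromℕ< i<)
    (trans (sym (nth-toℕ (f x) (fromℕ< i<))) (cong (nth (f x)) (toℕ-fromℕ< i<)))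
    (H-eval x (fromℕ< i<))

  module _ (x : ℕ → ℕ) (x-eval : ∀ y → Eval φ (x y ∷ 0 ∷ []) y) where

    -- The finitely many computations of values and list entries all halt by a common stage `s`,
    -- which is packed with the points and the blocks. The value at `x y` is `y`, so different `y`
    -- give different values.
    certificate : ∀ k ys → Unique ys → 2 ^ k ≤ length ys → (τ : ℕ → ℕ) →
      (∀ {y} → y ∈ ys → ∀ {p} → p ∈ f (x y) → Covered k τ p) → Σ ℕ (IsCertificate k)
    certificate k ys unique long τ cover
      with s , late ← eventually-∀< (2 ^ k) {λ r s →
               fun (stage φ) (s ∷ x (nth ys r) ∷ 0 ∷ []) ≡ suc (nth ys r) ×
               (∀ i → i < length (f (x (nth ys r))) →
                 fun (stage H) (s ∷ x (nth ys r) ∷ i ∷ []) ≡ suc (nth (f (x (nth ys r))) i))}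
             (λ r _ → eventually-zip (λ _ → _,_) (stage-complete φ (x-eval (nth ys r)))
               (eventually-∀< (length (f (x (nth ys r)))) λ i i< → stage-complete H (H-nth _ i i<)))
      with u , u-spec ← encode (2 ^ k) (x ∘ nth ys)
      with v , v-spec ← encode (dep k) τ
      with z , z-spec ← encode 3 (λ { 0 → s ; 1 → u ; _ → v })
      = z , record
      { converges = λ r r< → trans (value≡ r r<) (cong (λ v → suc (pred v)) (sym (value≡ r r<)))
      ; distinct = λ r r′ r< r′<r eq → nth-distinct unique r r′ (<-≤-trans r< long) r′<r
          (suc-injective (trans (sym (value≡ r r<)) (trans eq (value≡ r′ (<-trans r′<r r<)))))
      ; covered = covered-z }
      where
      s≡ : β z 0 ≡ s
      s≡ = z-spec 0 (s≤s z≤n)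
      point≡ : ∀ r → r < 2 ^ k → point z r ≡ x (nth ys r)
      point≡ r r< = trans (cong (λ w → β w r) (z-spec 1 (s≤s (s≤s z≤n)))) (u-spec r r<)
      value≡ : ∀ r → r < 2 ^ k → value z r ≡ suc (nth ys r)
      value≡ r r< = trans (cong₂ (λ s x → fun (stage φ) (s ∷ x ∷ 0 ∷ [])) s≡ (point≡ r r<))
        (proj₁ (late s ≤-refl r r<))
      blocks≡ : ∀ t → t < dep k → blocks z t ≡ τ t
      blocks≡ t t< = trans (cong (λ w → β w t) (z-spec 2 ≤-refl)) (v-spec t t<)
      recode : ∀ {p} → Covered k τ p → Covered k (blocks z) p
      recode (inj₁ a) = inj₁ a
      recode {p} (inj₂ (t , t< , b)) = inj₂ (t , t< ,
        subst (λ w → w * width k ≤ p × p < w * width k + width k) (sym (blocks≡ t t<)) b)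
      covered-z : ∀ r i → r < 2 ^ k → i < length (f (point z r)) →
        listed z r i ≡ suc (pred (listed z r i)) × Covered k (blocks z) (pred (listed z r i))
      covered-z r i r< i< = trans listed≡ (cong (λ v → suc (pred v)) (sym listed≡)) ,
        subst (Covered k (blocks z)) (sym (cong pred listed≡))
          (recode (cover (nth-∈ ys (<-≤-trans r< long)) (nth-∈ _ i<′)))
        where
        i<′ = subst (λ w → i < length (f w)) (point≡ r r<) i<
        listed≡ : listed z r i ≡ suc (nth (f (x (nth ys r))) i)
        listed≡ = trans (cong₂ (λ s x → fun (stage H) (s ∷ x ∷ i ∷ [])) s≡ (point≡ r r<))
          (proj₂ (late s ≤-refl r r<) i i<′)

    module _ (c a : ℕ) (πˡ-c : πˡ (suc c + a) ≡ c) where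
      open Levels c a πˡ-c

      -- One factor 2 for each bisection: `2 ^ a` of them by sparse levels and `2 ^ j` by blocks
      -- met. The last factor is what survives, at least `2 ^ k` for every level `k`.
      total : ℕ
      total = 2 ^ 2 ^ a * (2 ^ 2 ^ j * 2 ^ 2 ^ suc j)

      -- After the first bisections all surviving lists have the same sparse levels; after the
      -- second, at one such level, they meet the same blocks. The blocks of a single list then
      -- serve for all.
      certificate-exists : (∀ y → y < total → length (f (x y)) ≤ 2 ^ a * 2 ^ a) →
        Σ ℕ λ i → i < 2 ^ a × Σ ℕ (IsCertificate (level i))
      certificate-exists short
        with ys₁ , unique₁ , sub₁ , long₁ , same₁ ← homogenize (2 ^ a)
               {λ i y → count (θ i) (θ (suc i)) (f (x y)) ≤ 2 ^ a} (λ i y → _ ≤? _)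
               (2 ^ 2 ^ j * 2 ^ 2 ^ suc j) (upTo total) (upTo⁺ total) (≤-reflexive (sym (length-upTo total)))
        with y₁∈ ← nth-∈ ys₁ {0} (≤-trans (*-mono-≤ (m^n>0 2 (2 ^ j)) (m^n>0 2 (2 ^ suc j))) long₁)
        -- `2 ^ a * 2 ^ a < 2 ^ a * suc (2 ^ a)`, so one of the `2 ^ a` levels has at most `2 ^ a`
        -- entries.
        with i , i< , sparse₁ ← sparse-level θ θ-mono (2 ^ a) (f (x (nth ys₁ 0))) (2 ^ a)
               (≤-<-trans (short _ (∈-upTo⁻ (sub₁ y₁∈))) (*-monoʳ-< (2 ^ a) {{m^n≢0 2 a}} (n<1+n (2 ^ a))))
        = i , i< , proof
        where
        k = level i
        instance
          width≢0 : NonZero (width k)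
          width≢0 = m^n≢0 2 (k + C k ∸ lg k)
        block : ℕ → ℕ
        block p = p / width k
        Hit : ℕ → ℕ → Set
        Hit q y = Any (λ p → Within (θ i) (θ (suc i)) p × block p ≡ q) (f (x y))
        proof : Σ ℕ (IsCertificate k)
        proof
          with ys , unique , sub , long , same ← homogenize (2 ^ j) {Hit}
                 (λ q y → any? (λ p → within? _ _ p ×-dec (block p ≟ q)) (f (x y)))
                 (2 ^ 2 ^ suc j) ys₁ unique₁ long₁
          = certificate k ys unique (≤-trans (^-monoʳ-≤ 2 (<⇒≤ (level-< i<))) long) (nth τs) cover
          where
          y₀ = nth ys 0
          y₀∈ = nth-∈ ys {0} (≤-trans (m^n>0 2 (2 ^ suc j)) long)
          window = filter (within? (θ i) (θ (suc i))) (f (x y₀))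
          τs = Data.List.map block window
          τs-short : length τs ≤ dep k
          τs-short = begin
            length τs       ≡⟨ length-map block window ⟩
            -- Sparseness was shown for the first survivor of the first round and passes to `y₀`.
            length window   ≤⟨ same₁ i i< y₁∈ (sub y₀∈) sparse₁ ⟩
            2 ^ a           ≡⟨ dep-level i< ⟨
            dep k           ∎
            where open ≤-Reasoning
          cover : ∀ {y} → y ∈ ys → ∀ {p} → p ∈ f (x y) → Covered k (nth τs) p
          cover {y} y∈ {p} p∈ with p <? lo k | hi k ≤? p
          ... | yes p<lo | _ = inj₁ (inj₁ p<lo)
          ... | no _ | yes hi≤p = inj₁ (inj₂ hi≤p)
          ... | no p≮lo | no hi≰p = inj₂ (toℕ t , <-≤-trans (toℕ<n t) τs-short ,
              subst (λ q → q * width k ≤ p × p < q * width k + width k) (sym nth-t) (m/n*n≤m p (width k) , p<next))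
            where
            p<hi = ≰⇒> hi≰p
            shared : Hit (block p) y₀
            -- The block of `p` is met by the list for `y`, hence also by that for `y₀`, from which
            -- `τs` was read.
            shared = same (block p) (m<n*o⇒m/o<n (<-≤-trans p<hi (≤-reflexive (hi-level i<)))) y∈ y₀∈
              (lose p∈ ((≮⇒≥ p≮lo , <-≤-trans p<hi (hi≤θ i<)) , refl))
            block∈ : block p ∈ τs
            block∈ with p₀ , p₀∈ , within₀ , eq ← find shared =
              subst (_∈ τs) eq (∈-map⁺ block (∈-filter⁺ (within? (θ i) (θ (suc i))) p₀∈ within₀))
            t = index block∈
            nth-t : nth τs (toℕ t) ≡ block p
            nth-t = trans (nth-toℕ τs t) (sym (lookup-index block∈))
            p<next : p < p / width k * width k + width k
            p<next = begin-strict
              p                                          ≡⟨ m≡m%n+[m/n]*n p (width k) ⟩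
              p % width k + p / width k * width k        <⟨ +-monoˡ-< (p / width k * width k) (m%n<n p (width k) {{width≢0}}) ⟩
              width k + p / width k * width k            ≡⟨ +-comm (width k) _ ⟩
              p / width k * width k + width k            ∎
              where open ≤-Reasoning

≤-sumTo : ∀ n a {i} → i < n → a i ≤ sumTo n a
≤-sumTo (suc n) a {i} i<1+n with m≤n⇒m<n∨m≡n (≤-pred i<1+n)
... | inj₁ i<n = ≤-trans (≤-sumTo n a i<n) (m≤n+m _ (a n))
... | inj₂ refl = m≤m+n (a n) _

m≤m*m : ∀ m → m ≤ m * m
m≤m*m zero = z≤n
m≤m*m (suc m) = m≤m+n (suc m) (m * suc m)

-- Enumerating the points of the first certificates

module Enumeration (φ : Numbering) (f : ℕ → List ℕ) (L : PR 1) (H : PR 2)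
  (L-eval : ∀ x → Eval L (x ∷ []) (length (f x)))
  (H-eval : ∀ x (i : Fin (length (f x))) → Eval H (x ∷ toℕ i ∷ []) (Data.List.lookup (f x) i))
  where
  open Certificates φ f L H L-eval H-eval

  pick : Fn 2
  pick = ap pointᶠ (arg #0 ∷ arg #1 ∸ᶠ 2^ᶠ lgᶠ (arg #1) ∷ [])

  -- At 2 ^ k + r with r < 2 ^ k, the r-th point of the first certificate of level k.
  G : PR 1
  G = comp (code pick) (comp (mu (code failure)) (code (lgᶠ {1} (arg #0)) ∷ []) ∷ P #0 ∷ [])

  G-eval : ∀ k r {z} → r < 2 ^ k → Eval (mu (code failure)) (k ∷ []) z →
    Eval G (2 ^ k + r ∷ []) (point z r)
  G-eval k r {z} r< ev = subst (Eval G (e ∷ []))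
      (cong (point z) (trans (cong (λ v → e ∸ 2 ^ v) lg-e) (m+n∸m≡n (2 ^ k) r)))
      (eComp (eComp (sound (lgᶠ (arg #0)) (e ∷ []) ∷ []) (subst (λ v → Eval (mu (code failure)) (v ∷ []) z) (sym lg-e) ev) ∷ eP ∷ [])
             (sound pick (z ∷ e ∷ [])))
    where
    e = 2 ^ k + r
    lg-e : lg e ≡ k
    lg-e = lg-unique k e (m≤m+n (2 ^ k) r)
      (+-monoʳ-< (2 ^ k) (<-≤-trans r< (≤-reflexive (sym (+-identityʳ (2 ^ k))))))

  EnumerationBound : ℕ → Set
  EnumerationBound c = ∀ k z → C k ≡ suc c → Eval (mu (code failure)) (k ∷ []) z →
    ∀ r j → r < 2 ^ k → IsMinIndex φ (point z r) j → j < hi k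

  -- The input `e = 2 ^ k + r` is below `2 ^ suc k`, so `c * e + c` is below `2 ^ (c + suc k)`,
  -- which is `hi k` when `C k` is `suc c`. The program `G` decodes `C` from its input, so `c` is
  -- known before `C` is chosen.
  enumeration-bound : Kolmogorov φ → Σ ℕ EnumerationBound
  enumeration-bound kol = bound (min-index-of-enumerated φ kol G)
    where
    bound : (Σ ℕ λ c → ∀ e v j → Eval G (e ∷ []) v → IsMinIndex φ v j → j ≤ c * e + c) →
      Σ ℕ EnumerationBound
    bound (c , small) = c , λ k z C≡ ev r j r< isMin → begin-strict
      j                        ≤⟨ small (2 ^ k + r) (point z r) j (G-eval k r r< ev) isMin ⟩
      c * (2 ^ k + r) + c      ≡⟨ +-comm (c * (2 ^ k + r)) c ⟩
      c + c * (2 ^ k + r)      ≡⟨ *-suc c (2 ^ k + r) ⟨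
      c * suc (2 ^ k + r)      ≡⟨ cong (c *_) (+-suc (2 ^ k) r) ⟨
      c * (2 ^ k + suc r)      ≤⟨ *-monoʳ-≤ c (+-monoʳ-≤ (2 ^ k) (≤-trans r< (m≤m+n (2 ^ k) 0))) ⟩
      c * 2 ^ suc k            <⟨ *-monoˡ-< (2 ^ suc k) {{m^n≢0 2 (suc k)}} (n<2^n c) ⟩
      2 ^ c * 2 ^ suc k        ≡⟨ ^-distribˡ-+-* 2 c (suc k) ⟨
      2 ^ (c + suc k)          ≡⟨ cong (2 ^_) (trans (+-suc c k) (+-comm (suc c) k)) ⟩
      2 ^ (k + suc c)          ≡⟨ cong (λ v → 2 ^ (k + v)) C≡ ⟨
      hi k                     ∎
      where open ≤-Reasoning

  open Existence φ f L H L-eval H-eval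

  -- The search may stop at another certificate than the one shown to exist, but the one it finds is
  -- refuted, as `G` lists its points.
  lists-not-short : (∀ x → Σ ℕ λ j → IsMinIndex φ x j × j ∈ f x) →
    ∀ c → EnumerationBound c →
    (x : ℕ → ℕ) (x-eval : ∀ y → Eval φ (x y ∷ 0 ∷ []) y) →
    ∀ a (πˡ-c : πˡ (suc (suc c) + a) ≡ suc c) →
    ¬ (∀ y → y < total x x-eval (suc c) a πˡ-c → length (f (x y)) ≤ 2 ^ a * 2 ^ a)
  lists-not-short lists-min c bound x x-eval a πˡ-c short
    = refute (certificate-exists x x-eval (suc c) a πˡ-c short)
    where
    open Levels (suc c) a πˡ-c
    refute′ : ∀ {i} → i < 2 ^ a → Σ ℕ (λ z → fun failure (z ∷ level i ∷ []) ≡ 0 × Eval (mu (code failure)) (level i ∷ []) z) → ⊥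
    refute′ {i} i< (z , failure≡0 , ev) =
      no-certificate lists-min (level i) z (failure≡0⇒ (level i) z failure≡0) (room i<) (bound (level i) z (C-level i<) ev)
    refute : (Σ ℕ λ i → i < 2 ^ a × Σ ℕ (IsCertificate (level i))) → ⊥
    refute (i , i< , z , cert) = refute′ i< (mu-complete failure (level i ∷ []) z (⇒failure≡0 (level i) z cert))

-- From short lists to the squared logarithm

scaled-bound : ∀ s m {t l} → 25 * (s * s) ≤ t → 1 ≤ s → t * l ≤ 25 * ((s * m) * (s * m)) → l ≤ m * m
scaled-bound (suc s) m {t} {l} le _ p = *-cancelˡ-≤ (25 * (suc s * suc s)) (begin
  25 * (suc s * suc s) * l           ≤⟨ *-monoˡ-≤ l le ⟩
  t * l                              ≤⟨ p ⟩
  25 * (suc s * m * (suc s * m))     ≡⟨ regroup (suc s) m ⟩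
  25 * (suc s * suc s) * (m * m)     ∎)
  where
  open ≤-Reasoning
  regroup : ∀ s m → 25 * ((s * m) * (s * m)) ≡ (25 * (s * s)) * (m * m)
  regroup = solve-∀

log²-≤ : ∀ x n → x ≤ 2 ^ (5 * n) → log² x ≤ 25 * (n * n)
log²-≤ x n le = ≤-trans (*-mono-≤ log≤ log≤) (≤-reflexive (regroup n))
  where
  log≤ : ⌊log₂ x ⌋ ≤ 5 * n
  log≤ = ≤-trans (⌊log₂⌋-mono-≤ le) (≤-reflexive (⌊log₂[2^n]⌋≡n (5 * n)))
  regroup : ∀ n → (5 * n) * (5 * n) ≡ 25 * (n * n)
  regroup = solve-∀

module _ (f : ℕ → List ℕ) (x : ℕ → ℕ) (c₀ : ℕ) (x-bound : ∀ y → x y ≤ c₀ * y + c₀) where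

  -- `x y` is at most `c₀ * suc y`, hence at most `2 ^ n * 2 ^ (4 * n)`; so its squared logarithm is
  -- at most `25 * (n * n)`. Cancelling `25 * (s * s)` leaves `m * m`.
  lists-short : ∀ t N s m n M → n ≡ s * m → 25 * (s * s) ≤ t → 1 ≤ s →
    c₀ + t * sumTo N (length ∘ f) ≤ n → M ≤ 2 ^ (4 * n) →
    ¬ (Σ ℕ λ y → y < M × (N ≤ x y) × log² (x y) ≤ t * length (f (x y))) →
    ∀ y → y < M → length (f (x y)) ≤ m * m
  lists-short t N s m n M refl le 1≤s large M≤ none y y<M = scaled-bound s m le 1≤s (cases (N ≤? x y))
    where
    open ≤-Reasoning
    x≤ : x y ≤ 2 ^ (5 * n)
    x≤ = begin
      x y                   ≤⟨ x-bound y ⟩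
      c₀ * y + c₀           ≡⟨ +-comm (c₀ * y) c₀ ⟩
      c₀ + c₀ * y           ≡⟨ *-suc c₀ y ⟨
      c₀ * suc y            ≤⟨ *-mono-≤ (≤-trans (≤-trans (m≤m+n c₀ _) large) (<⇒≤ (n<2^n n))) (≤-trans y<M M≤) ⟩
      2 ^ n * 2 ^ (4 * n)   ≡⟨ ^-distribˡ-+-* 2 n (4 * n) ⟨
      2 ^ (5 * n)           ∎
    cases : Dec (N ≤ x y) → t * length (f (x y)) ≤ 25 * (n * n)
    cases (yes N≤x) = ≤-trans (<⇒≤ (≰⇒> λ le → none (y , y<M , N≤x , le))) (log²-≤ (x y) n x≤)
    -- The finitely many lists at arguments below `N` are bounded by the sum of their lengths, which
    -- `n` dominates.
    cases (no N≰x) = begin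
      t * length (f (x y))             ≤⟨ *-monoʳ-≤ t (≤-sumTo N (length ∘ f) (≰⇒> N≰x)) ⟩
      t * sumTo N (length ∘ f)         ≤⟨ m≤n+m _ c₀ ⟩
      c₀ + t * sumTo N (length ∘ f)    ≤⟨ large ⟩
      n                                ≤⟨ m≤m*m n ⟩
      n * n                            ≤⟨ m≤m+n (n * n) _ ⟩
      25 * (n * n)                     ∎

-- Every constant is decoded from arbitrarily large exponents, since `pair c` is unbounded. Pairing
-- with `suc b` makes the pair at least `suc c`, so that the subtraction is exact.
large-exponent : ∀ c b → Σ ℕ λ a → πˡ (suc c + a) ≡ c × b ≤ suc c + a
large-exponent c b = pair c (suc b) ∸ suc c ,
  trans (cong πˡ restore) (πˡ-pair c (suc b)) ,
  ≤-trans (≤-trans (n≤1+n b) (≤-trans (m≤n+m (suc b) c) square≤)) (≤-reflexive (sym restore))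
  where
  square≤ : c + suc b ≤ pair c (suc b)
  square≤ = ≤-trans (m≤m*m (c + suc b)) (m≤m+n _ c)
  restore : suc c + (pair c (suc b) ∸ suc c) ≡ pair c (suc b)
  restore = m+[n∸m]≡n (≤-trans (≤-trans (s≤s (m≤m+n c b)) (≤-reflexive (sym (+-suc c b)))) square≤)

module _ {φ : Numbering} {f : ℕ → List ℕ} {L : PR 1} {H : PR 2}
  (L-eval : ∀ x → Eval L (x ∷ []) (length (f x)))
  (H-eval : ∀ x (i : Fin (length (f x))) → Eval H (x ∷ toℕ i ∷ []) (Data.List.lookup (f x) i))
  (lists-min : ∀ x → Σ ℕ λ j → IsMinIndex φ x j × j ∈ f x)
  where
  open Enumeration φ f L H L-eval H-eval
  open Existence φ f L H L-eval H-eval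

  -- The witness is sought among the finitely many `x y` with `y < M`, a decidable matter; if there
  -- is none, all these lists are short, which is impossible.
  long-list : ∀ c → EnumerationBound c → ∀ c₀ (x : ℕ → ℕ) → (∀ y → x y ≤ c₀ * y + c₀) →
    (∀ y → Eval φ (x y ∷ 0 ∷ []) y) → ∀ t → 25 * (2 ^ suc (suc c) * 2 ^ suc (suc c)) ≤ t →
    ∀ N → Σ ℕ λ x → (x ≥ N) × (log² x ≤ t * length (f x))
  long-list c bound c₀ x x-bound x-eval t t≥ N =
    search (large-exponent (suc c) (c₀ + t * sumTo N (length ∘ f)))
    where
    search : (Σ ℕ λ a → πˡ (suc (suc c) + a) ≡ suc c × c₀ + t * sumTo N (length ∘ f) ≤ suc (suc c) + a) →
      Σ ℕ λ x → (x ≥ N) × (log² x ≤ t * length (f x))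
    search (a , πˡ-c , large) = extract (anyUpTo? (λ y → (N ≤? x y) ×-dec (log² (x y) ≤? t * length (f (x y)))) M)
      where
      M = total x x-eval (suc c) a πˡ-c
      j = suc (suc c) + a
      n = 2 ^ j
      M≤ : M ≤ 2 ^ (4 * n)
      M≤ = begin
        2 ^ 2 ^ a * (2 ^ n * 2 ^ 2 ^ suc j)   ≡⟨ cong (2 ^ 2 ^ a *_) (^-distribˡ-+-* 2 n (2 ^ suc j)) ⟨
        2 ^ 2 ^ a * 2 ^ (n + 2 ^ suc j)       ≡⟨ ^-distribˡ-+-* 2 (2 ^ a) (n + 2 ^ suc j) ⟨
        -- `2 ^ a` is at most `n`, as `a` is at most `j`.
        2 ^ (2 ^ a + (n + 2 * n))             ≤⟨ ^-monoʳ-≤ 2 (+-monoˡ-≤ (n + 2 * n) (^-monoʳ-≤ 2 (m≤n+m a (suc (suc c))))) ⟩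
        2 ^ (4 * n)                           ∎
        where open ≤-Reasoning
      extract : Dec (Σ ℕ λ y → y < M × (N ≤ x y) × log² (x y) ≤ t * length (f (x y))) →
        Σ ℕ λ x → (x ≥ N) × (log² x ≤ t * length (f x))
      extract (yes (y , _ , N≤x , le)) = x y , N≤x , le
      extract (no none) = ⊥-elim (lists-not-short lists-min c bound x x-eval a πˡ-c
        (lists-short f x c₀ x-bound t N (2 ^ suc (suc c)) (2 ^ a) n M (^-distribˡ-+-* 2 (suc (suc c)) a)
          t≥ (m^n>0 2 (suc (suc c))) (≤-trans large (<⇒≤ (n<2^n j))) M≤ none))

theorem4p5 : (φ : Numbering) → Kolmogorov φ →
    (f : ℕ → List ℕ) → ComputableList f →
    (∀ x → Σ ℕ λ j → IsMinIndex φ x j × j ∈ f x) →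
    Σ ℕ λ k → ∀ N → Σ ℕ λ x → (x ≥ N) × (log² x ≤ suc k * length (f x))
theorem4p5 φ kol f (L , H , L-eval , H-eval) lists-min =
  -- In the numbering `P #0` the `e`-th function is constantly `e`.
  conclude (kol (P #0)) (Enumeration.enumeration-bound φ f L H L-eval H-eval kol)
  where
  -- The points φ-index the constant functions.
  conclude : (Σ ℕ λ c → (0 < c) × Σ (ℕ → ℕ) λ t → ∀ e → (t e ≤ c * e + c) × SameFn φ (t e) (P #0) e) →
    Σ ℕ (Enumeration.EnumerationBound φ f L H L-eval H-eval) →
    Σ ℕ λ k → ∀ N → Σ ℕ λ x → (x ≥ N) × (log² x ≤ suc k * length (f x))
  conclude (c₀ , _ , x , x-spec) (c , bound) = k , long-list L-eval H-eval lists-min c bound c₀ x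
      (λ y → proj₁ (x-spec y)) (λ y → Equivalence.from (proj₂ (x-spec y) 0 y) eP) (suc k) (n≤1+n k)
    -- The base of the square is the ratio `2 ^ j / 2 ^ a` for `j = suc (suc c) + a`.
    where k = 25 * (2 ^ suc (suc c) * 2 ^ suc (suc c))
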